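{- Fix $\mathcal S$, $\mathcal A$, $\mathcal R$, and consider the PTSC and the PTS they determine. (1) If $\Gamma\vdash M:A$ then $\mathcal B(\Gamma)\vdash_{\mathsf{PTS}}\mathcal B(M):\mathcal B(A)$. (2) If $\Gamma;B\vdash l:C$ then $\mathcal B(\Gamma),y:\mathcal B(B)\vdash_{\mathsf{PTS}}\mathcal B^y(l):\mathcal B(C)$ for any fresh variable $y$. (3) If $\Gamma\ \mathsf{wf}$ in the PTSC then $\mathcal B(\Gamma)\ \mathsf{wf}$ in the PTS.
   Context: Ground PTSC syntax: given sorts $\mathcal S$ and variables, terms $M ::= \Pi x^{A}.B \mid \lambda x^{A}.M \mid s \mid x\,l \mid M\,l \mid \langle N/x\rangle_A M$ and lists $l ::= [\,] \mid M\cdot l \mid l @ l' \mid \langle N/x\rangle_A l$ ($\langle N/x\rangle_A$ explicit substitution binding $x$; $\Pi,\lambda$ bind $x$). Reduction $\to$ is the contextual closure of: $(\lambda x^A.M)(N\cdot l)\to(\langle N/x\rangle_A M)\,l$; $M\,[\,]\to M$; $(x\,l)\,l'\to x\,(l@l')$; $(M\,l)\,l'\to M\,(l@l')$; $(M\cdot l')@l\to M\cdot(l'@l)$; $[\,]@l\to l$; $(l@l')@l''\to l@(l'@l'')$; $l@[\,]\to l$; $\langle P/y\rangle_G(\lambda x^A.M)\to\lambda x^{\langle P/y\rangle_G A}.\langle P/y\rangle_G M$; $\langle P/y\rangle_G(y\,l)\to P\,(\langle P/y\rangle_G l)$; $\langle P/y\rangle_G(x\,l)\to x\,(\langle P/y\rangle_G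 l)$ ($x\ne y$); $\langle P/y\rangle_G(M\,l)\to(\langle P/y\rangle_G M)(\langle P/y\rangle_G l)$; $\langle P/y\rangle_G(\Pi x^A.B)\to\Pi x^{\langle P/y\rangle_G A}.\langle P/y\rangle_G B$; $\langle P/y\rangle_G s\to s$; $\langle P/y\rangle_G[\,]\to[\,]$; $\langle P/y\rangle_G(M\cdot l)\to(\langle P/y\rangle_G M)\cdot(\langle P/y\rangle_G l)$; $\langle P/y\rangle_G(l@l')\to(\langle P/y\rangle_G l)@(\langle P/y\rangle_G l')$; $\leftrightarrow^*$ is the induced equivalence. PTSC typing (parameters $\mathcal A\subseteq\mathcal S^2$, $\mathcal R\subseteq\mathcal S^3$): environments are lists of $(x:A)$; $\langle P/x\rangle_A\Delta$ applies the substitution to every type of $\Delta$; $\Gamma\sqsubseteq\Delta$ means each $(x:A)\in\Gamma$ has some $(x:B)\in\Delta$ with $A\leftrightarrow^*B$. Rules: $\emptyset\ \mathsf{wf}$; $\Gamma\vdash A:s$, $x\notin\mathrm{dom}\,\Gamma\Rightarrow\Gamma,(x:A)\ \mathsf{wf}$; $\Gamma\ \mathsf{wf}$, $(s,s')\in\mathcal A\Rightarrow\Gamma\vdash s:s'$; $\Gamma\vdash A:s_1$, $\Gamma,(x:A)\vdash B:s_2$, $(s_1,s_2,s_3)\in\mathcal R\Rightarrow\Gamma\vdash\Pi x^A.B:s_3$; $\Gamma\vdash\Pi x^A.B:s$, $\Gamma,(x:A)\vdash M:B\Rightarrow\Gamma\vdash\lambda x^A.M:\Pi x^A.B$; $\Gamma;A\vdash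 l:B$, $(x:A)\in\Gamma\Rightarrow\Gamma\vdash x\,l:B$; $\Gamma\vdash A:s\Rightarrow\Gamma;A\vdash[\,]:A$; $\Gamma\vdash M:A$, $\Gamma\vdash B:s$, $A\leftrightarrow^*B\Rightarrow\Gamma\vdash M:B$; $\Gamma\vdash\Pi x^A.B:s$, $\Gamma\vdash M:A$, $\Gamma;\langle M/x\rangle_A B\vdash l:C\Rightarrow\Gamma;\Pi x^A.B\vdash M\cdot l:C$; $\Gamma;C\vdash l:A$, $\Gamma\vdash B:s$, $A\leftrightarrow^*B\Rightarrow\Gamma;C\vdash l:B$; $\Gamma;A\vdash l:C$, $\Gamma\vdash B:s$, $A\leftrightarrow^*B\Rightarrow\Gamma;B\vdash l:C$; $\Gamma;C\vdash l':A$, $\Gamma;A\vdash l:B\Rightarrow\Gamma;C\vdash l'@l:B$; $\Gamma\vdash P:A$, $\Gamma,(x:A),\Delta;B\vdash l:C$, $\Gamma,\langle P/x\rangle_A\Delta\sqsubseteq\Delta'$, $\Delta'\ \mathsf{wf}\Rightarrow\Delta';\langle P/x\rangle_A B\vdash\langle P/x\rangle_A l:\langle P/x\rangle_A C$; $\Gamma\vdash M:A$, $\Gamma;A\vdash l:B\Rightarrow\Gamma\vdash M\,l:B$; $\Gamma\vdash P:A$, $\Gamma,(x:A),\Delta\vdash M:C$, $\Gamma,\langle P/x\rangle_A\Delta\sqsubseteq\Delta'$, $\Delta'\ \mathsf{wf}\Rightarrow\Delta'\vdash\langle P/x\rangle_A M:C'$ with $C'=C$ if $C\in\mathcal S$,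 else $C'=\langle P/x\rangle_A C$. PTS: terms $t,u,T,U ::= x\mid s\mid\Pi x^T.t\mid\lambda x^T.t\mid t\,u$, $\beta$-reduction $(\lambda x^v.t)u\to t\{x:=u\}$, $\leftrightarrow_\beta^*$ its equivalence. PTS typing rules (same $\mathcal S,\mathcal A,\mathcal R$): $\emptyset\ \mathsf{wf}$; $\Gamma\vdash_{\mathsf{PTS}}T:s$, $x\notin\mathrm{dom}\,\Gamma\Rightarrow\Gamma,(x:T)\ \mathsf{wf}$; $\Gamma\ \mathsf{wf}$, $(x:T)\in\Gamma\Rightarrow\Gamma\vdash_{\mathsf{PTS}}x:T$; $\Gamma\ \mathsf{wf}$, $(s,s')\in\mathcal A\Rightarrow\Gamma\vdash_{\mathsf{PTS}}s:s'$; $\Gamma\vdash_{\mathsf{PTS}}U:s_1$, $\Gamma,(x:U)\vdash_{\mathsf{PTS}}T:s_2$, $(s_1,s_2,s_3)\in\mathcal R\Rightarrow\Gamma\vdash_{\mathsf{PTS}}\Pi x^U.T:s_3$; $\Gamma\vdash_{\mathsf{PTS}}\Pi x^U.T:s$, $\Gamma,(x:U)\vdash_{\mathsf{PTS}}t:T\Rightarrow\Gamma\vdash_{\mathsf{PTS}}\lambda x^U.t:\Pi x^U.T$; $\Gamma\vdash_{\mathsf{PTS}}t:\Pi x^U.T$, $\Gamma\vdash_{\mathsf{PTS}}u:U\Rightarrow\Gamma\vdash_{\mathsf{PTS}}t\,u:T\{x:=u\}$; $\Gamma\vdash_{\mathsf{PTS}}t:U$, $\Gamma\vdash_{\mathsf{PTS}}V:s$,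 $U\leftrightarrow_\beta^*V\Rightarrow\Gamma\vdash_{\mathsf{PTS}}t:V$. Translation $\mathcal B$ (PTSC to PTS): $\mathcal B(\Pi x^A.B)=\Pi x^{\mathcal B(A)}.\mathcal B(B)$, $\mathcal B(\lambda x^A.M)=\lambda x^{\mathcal B(A)}.\mathcal B(M)$, $\mathcal B(s)=s$, $\mathcal B(x\,l)=\mathcal B^z(l)\{z:=x\}$, $\mathcal B(M\,l)=\mathcal B^z(l)\{z:=\mathcal B(M)\}$ ($z$ fresh), $\mathcal B(\langle P/x\rangle_K M)=\mathcal B(M)\{x:=\mathcal B(P)\}$; $\mathcal B^y([\,])=y$, $\mathcal B^y(M\cdot l)=\mathcal B^z(l)\{z:=y\,\mathcal B(M)\}$, $\mathcal B^y(l@l')=\mathcal B^z(l')\{z:=\mathcal B^y(l)\}$ ($z$ fresh), $\mathcal B^y(\langle P/x\rangle_K l)=\mathcal B^y(l)\{x:=\mathcal B(P)\}$. On environments: $\mathcal B(\emptyset)=\emptyset$, $\mathcal B(\Gamma,(x:A))=\mathcal B(\Gamma),(x:\mathcal B(A))$. -}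

module Defs where

open import Data.Nat using (ℕ; suc; _≡ᵇ_; _⊔_)
open import Data.Bool using (Bool; true; false; if_then_else_; not)
open import Data.List using (List; []; _∷_; _++_; [_]; map; filterᵇ; foldr; concatMap)
open import Data.List.Membership.Propositional using (_∈_; _∉_)
open import Data.Product using (_×_; _,_; proj₁; ∃)
open import Data.Sum using (_⊎_)
open import Relation.Nullary using (¬_)
open import Relation.Nullary.Decidable using (⌊_⌋)
open import Relation.Binary.PropositionalEquality using (_≡_; _≢_)
open import Relation.Binary.Construct.Closure.Equivalence using (EqClosure)

-- Variables are names (natural numbers).  Terms are raw named terms; the
-- paper works modulo α-conversion, which is made explicit below.
Var : Set
Var = ℕ

swapv : Var → Var → Var → Var
swapv a b c = if c ≡ᵇ a then b else (if c ≡ᵇ b then a else c)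

del : Var → List Var → List Var
del x = filterᵇ (λ y → not (y ≡ᵇ x))

maxL : List Var → Var
maxL = foldr _⊔_ 0

freshFrom : List Var → Var
freshFrom xs = suc (maxL xs)

module Calculi (S : Set) (Ax : S → S → Set) (Rl : S → S → S → Set) where

  -- PTSC syntax
  --   Pi x A B      = Π x^A.B        (binds x in B)
  --   Lam x A M     = λ x^A.M        (binds x in M)
  --   srt s         = s
  --   var x l       = x l
  --   app M l       = M l
  --   esub N x A M  = ⟨N/x⟩_A M      (binds x in M)
  --   nil / cons M l / cat l l' / lsub N x A l
  --                 = [] / M·l / l@l' / ⟨N/x⟩_A l   (lsub binds x in l)
  mutual
    data Term : Set where
      Pi   : Var → Term → Term → Term
      Lam  : Var → Term → Term → Term
      srt  : S → Term
      var  : Var → Lst → Term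
      app  : Term → Lst → Term
      esub : Term → Var → Term → Term → Term

    data Lst : Set where
      nil  : Lst
      cons : Term → Lst → Lst
      cat  : Lst → Lst → Lst
      lsub : Term → Var → Term → Lst → Lst

  mutual
    fvT : Term → List Var
    fvT (Pi x A B) = fvT A ++ del x (fvT B)
    fvT (Lam x A M) = fvT A ++ del x (fvT M)
    fvT (srt s) = []
    fvT (var x l) = x ∷ fvL l
    fvT (app M l) = fvT M ++ fvL l
    fvT (esub N x A M) = fvT N ++ fvT A ++ del x (fvT M)

    fvL : Lst → List Var
    fvL nil = []
    fvL (cons M l) = fvT M ++ fvL l
    fvL (cat l l') = fvL l ++ fvL l'
    fvL (lsub N x A l) = fvT N ++ fvT A ++ del x (fvL l)

  mutual
    varsT : Term → List Var
    varsT (Pi x A B) = x ∷ varsT A ++ varsT B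
    varsT (Lam x A M) = x ∷ varsT A ++ varsT M
    varsT (srt s) = []
    varsT (var x l) = x ∷ varsL l
    varsT (app M l) = varsT M ++ varsL l
    varsT (esub N x A M) = x ∷ varsT N ++ varsT A ++ varsT M

    varsL : Lst → List Var
    varsL nil = []
    varsL (cons M l) = varsT M ++ varsL l
    varsL (cat l l') = varsL l ++ varsL l'
    varsL (lsub N x A l) = x ∷ varsT N ++ varsT A ++ varsL l

  mutual
    swT : Var → Var → Term → Term
    swT a b (Pi x A B) = Pi (swapv a b x) (swT a b A) (swT a b B)
    swT a b (Lam x A M) = Lam (swapv a b x) (swT a b A) (swT a b M)
    swT a b (srt s) = srt s
    swT a b (var x l) = var (swapv a b x) (swL a b l)
    swT a b (app M l) = app (swT a b M) (swL a b l)
    swT a b (esub N x A M) = esub (swT a b N) (swapv a b x) (swT a b A) (swT a b M)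

    swL : Var → Var → Lst → Lst
    swL a b nil = nil
    swL a b (cons M l) = cons (swT a b M) (swL a b l)
    swL a b (cat l l') = cat (swL a b l) (swL a b l')
    swL a b (lsub N x A l) = lsub (swT a b N) (swapv a b x) (swT a b A) (swL a b l)

  module _ (RT : Term → Term → Set) (RL : Lst → Lst → Set) where
    mutual
      data CtxT : Term → Term → Set where
        baseT : ∀ {M M'} → RT M M' → CtxT M M'
        Pi₁   : ∀ {x A A' B} → CtxT A A' → CtxT (Pi x A B) (Pi x A' B)
        Pi₂   : ∀ {x A B B'} → CtxT B B' → CtxT (Pi x A B) (Pi x A B')
        Lam₁  : ∀ {x A A' M} → CtxT A A' → CtxT (Lam x A M) (Lam x A' M)
        Lam₂  : ∀ {x A M M'} → CtxT M M' → CtxT (Lam x A M) (Lam x A M')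
        var₁  : ∀ {x l l'} → CtxL l l' → CtxT (var x l) (var x l')
        app₁  : ∀ {M M' l} → CtxT M M' → CtxT (app M l) (app M' l)
        app₂  : ∀ {M l l'} → CtxL l l' → CtxT (app M l) (app M l')
        esub₁ : ∀ {N N' x A M} → CtxT N N' → CtxT (esub N x A M) (esub N' x A M)
        esub₂ : ∀ {N x A A' M} → CtxT A A' → CtxT (esub N x A M) (esub N x A' M)
        esub₃ : ∀ {N x A M M'} → CtxT M M' → CtxT (esub N x A M) (esub N x A M')

      data CtxL : Lst → Lst → Set where
        baseL : ∀ {l l'} → RL l l' → CtxL l l'
        cons₁ : ∀ {M M' l} → CtxT M M' → CtxL (cons M l) (cons M' l)
        cons₂ : ∀ {M l l'} → CtxL l l' → CtxL (cons M l) (cons M l')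
        cat₁  : ∀ {l₁ l₁' l₂} → CtxL l₁ l₁' → CtxL (cat l₁ l₂) (cat l₁' l₂)
        cat₂  : ∀ {l₁ l₂ l₂'} → CtxL l₂ l₂' → CtxL (cat l₁ l₂) (cat l₁ l₂')
        lsub₁ : ∀ {N N' x A l} → CtxT N N' → CtxL (lsub N x A l) (lsub N' x A l)
        lsub₂ : ∀ {N x A A' l} → CtxT A A' → CtxL (lsub N x A l) (lsub N x A' l)
        lsub₃ : ∀ {N x A l l'} → CtxL l l' → CtxL (lsub N x A l) (lsub N x A l')

  data αT : Term → Term → Set where
    αPi   : ∀ {x y A B} → y ∉ fvT B → αT (Pi x A B) (Pi y A (swT x y B))
    αLam  : ∀ {x y A M} → y ∉ fvT M → αT (Lam x A M) (Lam y A (swT x y M))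
    αesub : ∀ {N x y A M} → y ∉ fvT M → αT (esub N x A M) (esub N y A (swT x y M))

  data αL : Lst → Lst → Set where
    αlsub : ∀ {N x y A l} → y ∉ fvL l → αL (lsub N x A l) (lsub N y A (swL x y l))

  -- the root reduction rules of the PTSC (side conditions = Barendregt's convention)
  data redT : Term → Term → Set where
    B-rule : ∀ {x A M N l} → redT (app (Lam x A M) (cons N l)) (app (esub N x A M) l)
    nil-T  : ∀ {M} → redT (app M nil) M
    var-cat : ∀ {x l l'} → redT (app (var x l) l') (var x (cat l l'))
    app-cat : ∀ {M l l'} → redT (app (app M l) l') (app M (cat l l'))
    s-Lam  : ∀ {P y G x A M} → x ≢ y → x ∉ fvT P → x ∉ fvT G →
             redT (esub P y G (Lam x A M)) (Lam x (esub P y G A) (esub P y G M))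
    s-varY : ∀ {P y G l} → redT (esub P y G (var y l)) (app P (lsub P y G l))
    s-varX : ∀ {P y G x l} → x ≢ y → redT (esub P y G (var x l)) (var x (lsub P y G l))
    s-app  : ∀ {P y G M l} → redT (esub P y G (app M l)) (app (esub P y G M) (lsub P y G l))
    s-Pi   : ∀ {P y G x A B} → x ≢ y → x ∉ fvT P → x ∉ fvT G →
             redT (esub P y G (Pi x A B)) (Pi x (esub P y G A) (esub P y G B))
    s-srt  : ∀ {P y G s} → redT (esub P y G (srt s)) (srt s)

  data redL : Lst → Lst → Set where
    cons-cat : ∀ {M l' l} → redL (cat (cons M l') l) (cons M (cat l' l))
    nil-cat  : ∀ {l} → redL (cat nil l) l
    cat-cat  : ∀ {l l' l''} → redL (cat (cat l l') l'') (cat l (cat l' l''))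
    cat-nil  : ∀ {l} → redL (cat l nil) l
    s-nil    : ∀ {P y G} → redL (lsub P y G nil) nil
    s-cons   : ∀ {P y G M l} → redL (lsub P y G (cons M l)) (cons (esub P y G M) (lsub P y G l))
    s-cat    : ∀ {P y G l l'} → redL (lsub P y G (cat l l')) (cat (lsub P y G l) (lsub P y G l'))

  _⟶_ : Term → Term → Set
  _⟶_ = CtxT redT redL

  _⟶ₗ_ : Lst → Lst → Set
  _⟶ₗ_ = CtxL redT redL

  _≈α_ : Term → Term → Set
  _≈α_ = EqClosure (CtxT αT αL)

  _≈αₗ_ : Lst → Lst → Set
  _≈αₗ_ = EqClosure (CtxL αT αL)

  _↔*_ : Term → Term → Set
  _↔*_ = EqClosure (λ M N → (M ⟶ N) ⊎ CtxT αT αL M N)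

  Env : Set
  Env = List (Var × Term)

  _,,_∶_ : Env → Var → Term → Env
  Γ ,, x ∶ A = Γ ++ [ (x , A) ]

  dom : Env → List Var
  dom = map proj₁

  substEnv : Term → Var → Term → Env → Env
  substEnv P x A = map (λ { (y , B) → (y , esub P x A B) })

  _⊑_ : Env → Env → Set
  Γ ⊑ Δ = ∀ {x A} → (x , A) ∈ Γ → ∃ λ B → ((x , B) ∈ Δ) × (A ↔* B)

  substTy : Term → Var → Term → Term → Term
  substTy P x A (srt s) = srt s
  substTy P x A C@(Pi _ _ _) = esub P x A C
  substTy P x A C@(Lam _ _ _) = esub P x A C
  substTy P x A C@(var _ _) = esub P x A C
  substTy P x A C@(app _ _) = esub P x A C
  substTy P x A C@(esub _ _ _ _) = esub P x A C

  infix 4 _wf _⊢_∶_ _⍮_⊢_∶_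

  mutual
    data _wf : Env → Set where
      wf-∅ : [] wf
      wf-, : ∀ {Γ x A s} → Γ ⊢ A ∶ srt s → x ∉ dom Γ → (Γ ,, x ∶ A) wf

    data _⊢_∶_ : Env → Term → Term → Set where
      t-srt  : ∀ {Γ s s'} → Γ wf → Ax s s' → Γ ⊢ srt s ∶ srt s'
      t-Pi   : ∀ {Γ x A B s₁ s₂ s₃} → Γ ⊢ A ∶ srt s₁ → (Γ ,, x ∶ A) ⊢ B ∶ srt s₂ →
               Rl s₁ s₂ s₃ → Γ ⊢ Pi x A B ∶ srt s₃
      t-Lam  : ∀ {Γ x A B M s} → Γ ⊢ Pi x A B ∶ srt s → (Γ ,, x ∶ A) ⊢ M ∶ B →
               Γ ⊢ Lam x A M ∶ Pi x A B
      t-var  : ∀ {Γ x A l B} → Γ ⍮ A ⊢ l ∶ B → (x , A) ∈ Γ → Γ ⊢ var x l ∶ B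
      t-conv : ∀ {Γ M A B s} → Γ ⊢ M ∶ A → Γ ⊢ B ∶ srt s → A ↔* B → Γ ⊢ M ∶ B
      t-app  : ∀ {Γ M A l B} → Γ ⊢ M ∶ A → Γ ⍮ A ⊢ l ∶ B → Γ ⊢ app M l ∶ B
      t-esub : ∀ {Γ Δ Δ' P x A M C} → Γ ⊢ P ∶ A → ((Γ ,, x ∶ A) ++ Δ) ⊢ M ∶ C →
               (Γ ++ substEnv P x A Δ) ⊑ Δ' → Δ' wf →
               Δ' ⊢ esub P x A M ∶ substTy P x A C
      t-α    : ∀ {Γ M M' A} → Γ ⊢ M ∶ A → M ≈α M' → Γ ⊢ M' ∶ A

    data _⍮_⊢_∶_ : Env → Term → Lst → Term → Set where
      l-nil   : ∀ {Γ A s} → Γ ⊢ A ∶ srt s → Γ ⍮ A ⊢ nil ∶ A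
      l-cons  : ∀ {Γ x A B M l C s} → Γ ⊢ Pi x A B ∶ srt s → Γ ⊢ M ∶ A →
                Γ ⍮ esub M x A B ⊢ l ∶ C → Γ ⍮ Pi x A B ⊢ cons M l ∶ C
      l-convR : ∀ {Γ C l A B s} → Γ ⍮ C ⊢ l ∶ A → Γ ⊢ B ∶ srt s → A ↔* B →
                Γ ⍮ C ⊢ l ∶ B
      l-convL : ∀ {Γ A l C B s} → Γ ⍮ A ⊢ l ∶ C → Γ ⊢ B ∶ srt s → A ↔* B →
                Γ ⍮ B ⊢ l ∶ C
      l-cat   : ∀ {Γ C l' A l B} → Γ ⍮ C ⊢ l' ∶ A → Γ ⍮ A ⊢ l ∶ B →
                Γ ⍮ C ⊢ cat l' l ∶ B
      l-lsub  : ∀ {Γ Δ Δ' P x A B l C} → Γ ⊢ P ∶ A → ((Γ ,, x ∶ A) ++ Δ) ⍮ B ⊢ l ∶ C →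
                (Γ ++ substEnv P x A Δ) ⊑ Δ' → Δ' wf →
                Δ' ⍮ esub P x A B ⊢ lsub P x A l ∶ esub P x A C
      l-α     : ∀ {Γ B l l' C} → Γ ⍮ B ⊢ l ∶ C → l ≈αₗ l' → Γ ⍮ B ⊢ l' ∶ C

  data PTerm : Set where
    pv  : Var → PTerm
    ps  : S → PTerm
    pΠ  : Var → PTerm → PTerm → PTerm
    pλ  : Var → PTerm → PTerm → PTerm
    _·_ : PTerm → PTerm → PTerm

  fvP : PTerm → List Var
  fvP (pv x) = x ∷ []
  fvP (ps s) = []
  fvP (pΠ x T t) = fvP T ++ del x (fvP t)
  fvP (pλ x T t) = fvP T ++ del x (fvP t)
  fvP (t · u) = fvP t ++ fvP u

  swP : Var → Var → PTerm → PTerm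
  swP a b (pv x) = pv (swapv a b x)
  swP a b (ps s) = ps s
  swP a b (pΠ x T t) = pΠ (swapv a b x) (swP a b T) (swP a b t)
  swP a b (pλ x T t) = pλ (swapv a b x) (swP a b T) (swP a b t)
  swP a b (t · u) = swP a b t · swP a b u

  upd : (Var → PTerm) → Var → PTerm → (Var → PTerm)
  upd σ x u y = if y ≡ᵇ x then u else σ y

  ssub : (Var → PTerm) → PTerm → PTerm
  ssub σ (pv x) = σ x
  ssub σ (ps s) = ps s
  ssub σ (pΠ x T t) =
    let z = freshFrom (concatMap (λ w → fvP (σ w)) (fvP (pΠ x T t)))
    in pΠ z (ssub σ T) (ssub (upd σ x (pv z)) t)
  ssub σ (pλ x T t) =
    let z = freshFrom (concatMap (λ w → fvP (σ w)) (fvP (pλ x T t)))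
    in pλ z (ssub σ T) (ssub (upd σ x (pv z)) t)
  ssub σ (t · u) = ssub σ t · ssub σ u

  _[_≔_] : PTerm → Var → PTerm → PTerm
  t [ x ≔ u ] = ssub (upd pv x u) t

  module _ (R : PTerm → PTerm → Set) where
    data CtxP : PTerm → PTerm → Set where
      baseP : ∀ {t t'} → R t t' → CtxP t t'
      pΠ₁   : ∀ {x T T' t} → CtxP T T' → CtxP (pΠ x T t) (pΠ x T' t)
      pΠ₂   : ∀ {x T t t'} → CtxP t t' → CtxP (pΠ x T t) (pΠ x T t')
      pλ₁   : ∀ {x T T' t} → CtxP T T' → CtxP (pλ x T t) (pλ x T' t)
      pλ₂   : ∀ {x T t t'} → CtxP t t' → CtxP (pλ x T t) (pλ x T t')
      ap₁   : ∀ {t t' u} → CtxP t t' → CtxP (t · u) (t' · u)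
      ap₂   : ∀ {t u u'} → CtxP u u' → CtxP (t · u) (t · u')

  data βroot : PTerm → PTerm → Set where
    β : ∀ {x v t u} → βroot (pλ x v t · u) (t [ x ≔ u ])

  data αP : PTerm → PTerm → Set where
    αpΠ : ∀ {x y T t} → y ∉ fvP t → αP (pΠ x T t) (pΠ y T (swP x y t))
    αpλ : ∀ {x y T t} → y ∉ fvP t → αP (pλ x T t) (pλ y T (swP x y t))

  _≈αₚ_ : PTerm → PTerm → Set
  _≈αₚ_ = EqClosure (CtxP αP)

  _↔β*_ : PTerm → PTerm → Set
  _↔β*_ = EqClosure (λ t u → CtxP βroot t u ⊎ CtxP αP t u)

  PEnv : Set
  PEnv = List (Var × PTerm)

  _,ₚ_∶_ : PEnv → Var → PTerm → PEnv
  Γ ,ₚ x ∶ T = Γ ++ [ (x , T) ]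

  infix 4 _wfₚ _⊢ₚ_∶_

  mutual
    data _wfₚ : PEnv → Set where
      pwf-∅ : [] wfₚ
      pwf-, : ∀ {Γ x T s} → Γ ⊢ₚ T ∶ ps s → x ∉ map proj₁ Γ → (Γ ,ₚ x ∶ T) wfₚ

    data _⊢ₚ_∶_ : PEnv → PTerm → PTerm → Set where
      p-var  : ∀ {Γ x T} → Γ wfₚ → (x , T) ∈ Γ → Γ ⊢ₚ pv x ∶ T
      p-srt  : ∀ {Γ s s'} → Γ wfₚ → Ax s s' → Γ ⊢ₚ ps s ∶ ps s'
      p-Π    : ∀ {Γ x U T s₁ s₂ s₃} → Γ ⊢ₚ U ∶ ps s₁ → (Γ ,ₚ x ∶ U) ⊢ₚ T ∶ ps s₂ →
               Rl s₁ s₂ s₃ → Γ ⊢ₚ pΠ x U T ∶ ps s₃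
      p-λ    : ∀ {Γ x U T t s} → Γ ⊢ₚ pΠ x U T ∶ ps s → (Γ ,ₚ x ∶ U) ⊢ₚ t ∶ T →
               Γ ⊢ₚ pλ x U t ∶ pΠ x U T
      p-app  : ∀ {Γ t x U T u} → Γ ⊢ₚ t ∶ pΠ x U T → Γ ⊢ₚ u ∶ U →
               Γ ⊢ₚ t · u ∶ (T [ x ≔ u ])
      p-conv : ∀ {Γ t U V s} → Γ ⊢ₚ t ∶ U → Γ ⊢ₚ V ∶ ps s → U ↔β* V → Γ ⊢ₚ t ∶ V
      p-α    : ∀ {Γ t t' T} → Γ ⊢ₚ t ∶ T → t ≈αₚ t' → Γ ⊢ₚ t' ∶ T

  mutual
    𝓑 : Term → PTerm
    𝓑 (Pi x A B) = pΠ x (𝓑 A) (𝓑 B)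
    𝓑 (Lam x A M) = pλ x (𝓑 A) (𝓑 M)
    𝓑 (srt s) = ps s
    𝓑 (var x l) = let z = freshFrom (varsL l) in 𝓑ˡ z l [ z ≔ pv x ]
    𝓑 (app M l) = let z = freshFrom (varsL l) in 𝓑ˡ z l [ z ≔ 𝓑 M ]
    𝓑 (esub P x K M) = 𝓑 M [ x ≔ 𝓑 P ]

    𝓑ˡ : Var → Lst → PTerm
    𝓑ˡ y nil = pv y
    𝓑ˡ y (cons M l) = let z = freshFrom (varsL l) in 𝓑ˡ z l [ z ≔ pv y · 𝓑 M ]
    𝓑ˡ y (cat l l') = let z = freshFrom (varsL l') in 𝓑ˡ z l' [ z ≔ 𝓑ˡ y l ]
    𝓑ˡ y (lsub P x K l) = 𝓑ˡ y l [ x ≔ 𝓑 P ]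

  𝓑ₑ : Env → PEnv
  𝓑ₑ = map (λ { (x , A) → (x , 𝓑 A) })

{-# OPTIONS --safe #-}
module Submission where

-- Named typing is routed through a PTS on de Bruijn terms, in which α-equivalence is equality.
-- Since only one direction is needed, that PTS may have unordered contexts, with free indices
-- playing the role of names, and redundant typing premises.  PTSC terms are interpreted in it
-- directly; the PTSC rules then hold by one substitution lemma, where the substituted terms
-- need the right type only up to conversion, so that it also gives weakening along ⊑.
-- A derivation is read back as a named one by picking fresh binders.  Two named terms with the
-- same de Bruijn image are α-equivalent, and 𝓑 M has the de Bruijn image of M, so the term read
-- back is 𝓑 M up to α.  Its type is adjusted by conversion: by type correctness it is a sort or
-- is itself typed.

open import Defs
open import Data.Bool using (true; false; if_then_else_)
open import Data.Empty using (⊥-elim)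
open import Data.List using (List; []; _∷_; _++_; [_]; map; concatMap; initLast; _∷ʳ′_)
open import Data.List.Properties using (map-++; ++-assoc; map-∘; ∷ʳ-injective; ∷ʳ-injectiveˡ)
open import Data.List.Membership.Propositional using (_∈_; _∉_; lose)
open import Data.List.Membership.Propositional.Properties
  using (∈-++⁺ˡ; ∈-++⁺ʳ; ∈-++⁻; ∈-map⁺; ∈-∃++; ∈-concatMap⁺)
open import Data.List.Relation.Binary.Subset.Propositional.Properties using (++⁺)
open import Data.List.Relation.Unary.Any using (here; there)
open import Data.Nat using (ℕ; zero; suc; _≤_; _≡ᵇ_)
open import Data.Nat.Properties using (_≟_; m≤m⊔n; m≤n⊔m; ≤-trans; <-irrefl)
open import Data.Product using (_×_; _,_; proj₁; proj₂; ∃-syntax)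
open import Data.Sum using (_⊎_; inj₁; inj₂)
open import Function using (_∘_; id)
import Relation.Binary.Construct.Closure.Equivalence as Eq
open import Relation.Binary.Structures using (IsEquivalence)
open import Relation.Binary.PropositionalEquality
  using (_≡_; _≢_; refl; sym; trans; cong; cong₂; subst; subst₂; isEquivalence)
open import Relation.Nullary using (yes; no)

-- Names: updates, swaps and freshness

_[_↦_] : {A : Set} → (Var → A) → Var → A → Var → A
(f [ x ↦ v ]) y = if y ≡ᵇ x then v else f y

≡ᵇ-refl : ∀ x → (x ≡ᵇ x) ≡ true
≡ᵇ-refl zero = refl
≡ᵇ-refl (suc x) = ≡ᵇ-refl x

≢⇒≡ᵇ-false : ∀ {y x} → y ≢ x → (y ≡ᵇ x) ≡ false
≢⇒≡ᵇ-false {zero} {zero} y≢x = ⊥-elim (y≢x refl)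
≢⇒≡ᵇ-false {zero} {suc x} y≢x = refl
≢⇒≡ᵇ-false {suc y} {zero} y≢x = refl
≢⇒≡ᵇ-false {suc y} {suc x} y≢x = ≢⇒≡ᵇ-false (y≢x ∘ cong suc)

module _ {A : Set} {f : Var → A} where

  ↦-same : ∀ x {v} → (f [ x ↦ v ]) x ≡ v
  ↦-same x rewrite ≡ᵇ-refl x = refl

  ↦-other : ∀ {x v y} → y ≢ x → (f [ x ↦ v ]) y ≡ f y
  ↦-other y≢x rewrite ≢⇒≡ᵇ-false y≢x = refl

close : Var → Var → ℕ
close x = suc [ x ↦ 0 ]

swapv-left : ∀ x y → swapv x y x ≡ y
swapv-left x y rewrite ≡ᵇ-refl x = refl

swapv-other : ∀ {x y w} → w ≢ x → w ≢ y → swapv x y w ≡ w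
swapv-other w≢x w≢y rewrite ≢⇒≡ᵇ-false w≢x | ≢⇒≡ᵇ-false w≢y = refl

swapv-right : ∀ x y → swapv x y y ≡ x
swapv-right x y with y ≟ x
... | yes refl = swapv-left x x
... | no y≢x rewrite ≢⇒≡ᵇ-false y≢x | ≡ᵇ-refl y = refl

swapv-injective : ∀ x y {v w} → swapv x y v ≡ swapv x y w → v ≡ w
swapv-injective x y {v} {w} eq =
  trans (sym (involutive v)) (trans (cong (swapv x y) eq) (involutive w))
  where
  involutive : ∀ v → swapv x y (swapv x y v) ≡ v
  involutive v with v ≟ x | v ≟ y
  ... | yes refl | _ = trans (cong (swapv x y) (swapv-left x y)) (swapv-right x y)
  ... | no _ | yes refl = trans (cong (swapv x y) (swapv-right x y)) (swapv-left x y)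
  ... | no v≢x | no v≢y = trans (cong (swapv x y) (swapv-other v≢x v≢y)) (swapv-other v≢x v≢y)

swapv-id : ∀ x v → swapv x x v ≡ v
swapv-id x v with v ≟ x
... | yes refl = swapv-left x x
... | no v≢x = swapv-other v≢x v≢x

freshFrom-∉ : ∀ xs → freshFrom xs ∉ xs
freshFrom-∉ xs x∈xs = <-irrefl refl (∈⇒≤maxL x∈xs)
  where
  ∈⇒≤maxL : ∀ {x xs} → x ∈ xs → x ≤ maxL xs
  ∈⇒≤maxL {xs = y ∷ xs} (here refl) = m≤m⊔n y (maxL xs)
  ∈⇒≤maxL {xs = y ∷ xs} (there x∈xs) = ≤-trans (∈⇒≤maxL x∈xs) (m≤n⊔m y (maxL xs))

∈-del : ∀ {w x xs} → w ∈ xs → w ≢ x → w ∈ del x xs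
∈-del {w} (here refl) w≢x rewrite ≢⇒≡ᵇ-false w≢x = here refl
∈-del {x = x} {y ∷ _} (there w∈xs) w≢x with y ≡ᵇ x
... | true = ∈-del w∈xs w≢x
... | false = there (∈-del w∈xs w≢x)

∈-del⁻ : ∀ {w x} xs → w ∈ del x xs → w ∈ xs
∈-del⁻ {x = x} (y ∷ xs) w∈ with y ≡ᵇ x
... | true = there (∈-del⁻ xs w∈)
∈-del⁻ (y ∷ xs) (here refl) | false = here refl
∈-del⁻ (y ∷ xs) (there w∈) | false = there (∈-del⁻ xs w∈)

-- Indices under a binder

down : List ℕ → List ℕ
down [] = []
down (zero ∷ is) = down is
down (suc i ∷ is) = i ∷ down is

∈-down : ∀ {i is} → suc i ∈ is → i ∈ down is
∈-down (here refl) = here refl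
∈-down {is = zero ∷ _} (there i∈) = ∈-down i∈
∈-down {is = suc _ ∷ _} (there i∈) = there (∈-down i∈)

lift : (ℕ → ℕ) → ℕ → ℕ
lift f zero = zero
lift f (suc i) = suc (f i)

down-lift : ∀ f is → down (map (lift f) is) ≡ map f (down is)
down-lift f [] = refl
down-lift f (zero ∷ is) = down-lift f is
down-lift f (suc i ∷ is) = cong (f i ∷_) (down-lift f is)

-- `down` is the nameless counterpart of `del`: closing `x` turns exactly its occurrences into index
-- 0, which `down` drops.
down-close : ∀ x xs → down (map (close x) xs) ≡ del x xs
down-close x [] = refl
down-close x (y ∷ xs) with y ≡ᵇ x
... | true = down-close x xs
... | false = cong (y ∷_) (down-close x xs)

infixr 5 _◂_
_◂_ : {A : Set} → A → (ℕ → A) → ℕ → A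
(a ◂ σ) zero = a
(a ◂ σ) (suc i) = σ i

module Soundness (S : Set) (Ax : S → S → Set) (Rl : S → S → S → Set) where

  open Calculi S Ax Rl

  -- De Bruijn terms and their substitution calculus

  infixl 9 _∙_

  -- De Bruijn terms whose free index i, at the root, stands for the name i; close x turns the
  -- body of a binder of the name x into the scope of a nameless binder.
  data Tm : Set where
    ix  : ℕ → Tm
    so  : S → Tm
    ∏ ƛ : Tm → Tm → Tm
    _∙_ : Tm → Tm → Tm

  fv : Tm → List ℕ
  fv (ix i) = [ i ]
  fv (so s) = []
  fv (∏ U T) = fv U ++ down (fv T)
  fv (ƛ U t) = fv U ++ down (fv t)
  fv (t ∙ u) = fv t ++ fv u

  ren : (ℕ → ℕ) → Tm → Tm
  ren f (ix i) = ix (f i)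
  ren f (so s) = so s
  ren f (∏ U T) = ∏ (ren f U) (ren (lift f) T)
  ren f (ƛ U t) = ƛ (ren f U) (ren (lift f) t)
  ren f (t ∙ u) = ren f t ∙ ren f u

  ↑_ : Tm → Tm
  ↑_ = ren suc

  exts : (ℕ → Tm) → ℕ → Tm
  exts σ = ix 0 ◂ (↑_ ∘ σ)

  sub : (ℕ → Tm) → Tm → Tm
  sub σ (ix i) = σ i
  sub σ (so s) = so s
  sub σ (∏ U T) = ∏ (sub σ U) (sub (exts σ) T)
  sub σ (ƛ U t) = ƛ (sub σ U) (sub (exts σ) t)
  sub σ (t ∙ u) = sub σ t ∙ sub σ u

  fv-ren : ∀ f t → fv (ren f t) ≡ map f (fv t)
  fv-ren-binder : ∀ f U T → fv (ren f U) ++ down (fv (ren (lift f) T)) ≡ map f (fv U ++ down (fv T))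
  fv-ren f (ix i) = refl
  fv-ren f (so s) = refl
  fv-ren f (∏ U T) = fv-ren-binder f U T
  fv-ren f (ƛ U t) = fv-ren-binder f U t
  fv-ren f (t ∙ u) = trans (cong₂ _++_ (fv-ren f t) (fv-ren f u)) (sym (map-++ f (fv t) (fv u)))
  fv-ren-binder f U T = trans
    (cong₂ _++_ (fv-ren f U) (trans (cong down (fv-ren (lift f) T)) (down-lift f (fv T))))
    (sym (map-++ f (fv U) (down (fv T))))

  exts-on : ∀ {σ τ is} → (∀ i → i ∈ down is → σ i ≡ τ i) → ∀ i → i ∈ is → exts σ i ≡ exts τ i
  exts-on σ≗τ zero _ = refl
  exts-on σ≗τ (suc i) i∈ = cong ↑_ (σ≗τ i (∈-down i∈))

  -- Freshness of a chosen name only says something about indices that occur, hence agreement on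
  -- free indices rather than everywhere.
  sub-on : ∀ {σ τ} t → (∀ i → i ∈ fv t → σ i ≡ τ i) → sub σ t ≡ sub τ t
  sub-on (ix i) σ≗τ = σ≗τ i (here refl)
  sub-on (so s) σ≗τ = refl
  sub-on (∏ U T) σ≗τ = cong₂ ∏ (sub-on U λ i → σ≗τ i ∘ ∈-++⁺ˡ)
    (sub-on T (exts-on λ i → σ≗τ i ∘ ∈-++⁺ʳ (fv U)))
  sub-on (ƛ U t) σ≗τ = cong₂ ƛ (sub-on U λ i → σ≗τ i ∘ ∈-++⁺ˡ)
    (sub-on t (exts-on λ i → σ≗τ i ∘ ∈-++⁺ʳ (fv U)))
  sub-on (t ∙ u) σ≗τ = cong₂ _∙_ (sub-on t λ i → σ≗τ i ∘ ∈-++⁺ˡ)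
    (sub-on u λ i → σ≗τ i ∘ ∈-++⁺ʳ (fv t))

  sub-cong : ∀ {σ τ} → (∀ i → σ i ≡ τ i) → ∀ t → sub σ t ≡ sub τ t
  sub-cong σ≗τ t = sub-on t λ i _ → σ≗τ i

  ren≡sub : ∀ f t → ren f t ≡ sub (ix ∘ f) t
  exts-ix : ∀ f i → ix (lift f i) ≡ exts (ix ∘ f) i
  ren≡sub f (ix i) = refl
  ren≡sub f (so s) = refl
  ren≡sub f (∏ U T) = cong₂ ∏ (ren≡sub f U) (trans (ren≡sub (lift f) T) (sub-cong (exts-ix f) T))
  ren≡sub f (ƛ U t) = cong₂ ƛ (ren≡sub f U) (trans (ren≡sub (lift f) t) (sub-cong (exts-ix f) t))
  ren≡sub f (t ∙ u) = cong₂ _∙_ (ren≡sub f t) (ren≡sub f u)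
  exts-ix f zero = refl
  exts-ix f (suc i) = refl

  -- The fusion laws build on one another at binders: `ren-sub` needs `ren-ren`, which follows from
  -- this law, and `sub-sub` needs this law and `ren-sub`.
  sub-ren : ∀ σ f t → sub σ (ren f t) ≡ sub (σ ∘ f) t
  sub-ren σ f (ix i) = refl
  sub-ren σ f (so s) = refl
  sub-ren σ f (∏ U T) = cong₂ ∏ (sub-ren σ f U)
    (trans (sub-ren (exts σ) (lift f) T) (sub-cong (λ { zero → refl ; (suc i) → refl }) T))
  sub-ren σ f (ƛ U t) = cong₂ ƛ (sub-ren σ f U)
    (trans (sub-ren (exts σ) (lift f) t) (sub-cong (λ { zero → refl ; (suc i) → refl }) t))
  sub-ren σ f (t ∙ u) = cong₂ _∙_ (sub-ren σ f t) (sub-ren σ f u)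

  ren-ren : ∀ f g t → ren f (ren g t) ≡ ren (f ∘ g) t
  ren-ren f g t = trans (ren≡sub f (ren g t)) (trans (sub-ren (ix ∘ f) g t) (sym (ren≡sub (f ∘ g) t)))

  ren-sub : ∀ f σ t → ren f (sub σ t) ≡ sub (ren f ∘ σ) t
  ren-exts : ∀ f σ i → ren (lift f) (exts σ i) ≡ exts (ren f ∘ σ) i
  ren-sub f σ (ix i) = refl
  ren-sub f σ (so s) = refl
  ren-sub f σ (∏ U T) = cong₂ ∏ (ren-sub f σ U)
    (trans (ren-sub (lift f) (exts σ) T) (sub-cong (ren-exts f σ) T))
  ren-sub f σ (ƛ U t) = cong₂ ƛ (ren-sub f σ U)
    (trans (ren-sub (lift f) (exts σ) t) (sub-cong (ren-exts f σ) t))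
  ren-sub f σ (t ∙ u) = cong₂ _∙_ (ren-sub f σ t) (ren-sub f σ u)
  ren-exts f σ zero = refl
  ren-exts f σ (suc i) = trans (ren-ren (lift f) suc (σ i)) (sym (ren-ren suc f (σ i)))

  sub-sub : ∀ τ σ t → sub τ (sub σ t) ≡ sub (sub τ ∘ σ) t
  exts-sub : ∀ τ σ i → sub (exts τ) (exts σ i) ≡ exts (sub τ ∘ σ) i
  sub-sub τ σ (ix i) = refl
  sub-sub τ σ (so s) = refl
  sub-sub τ σ (∏ U T) = cong₂ ∏ (sub-sub τ σ U)
    (trans (sub-sub (exts τ) (exts σ) T) (sub-cong (exts-sub τ σ) T))
  sub-sub τ σ (ƛ U t) = cong₂ ƛ (sub-sub τ σ U)
    (trans (sub-sub (exts τ) (exts σ) t) (sub-cong (exts-sub τ σ) t))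
  sub-sub τ σ (t ∙ u) = cong₂ _∙_ (sub-sub τ σ t) (sub-sub τ σ u)
  exts-sub τ σ zero = refl
  exts-sub τ σ (suc i) = trans (sub-ren (exts τ) suc (σ i)) (sym (ren-sub suc τ (σ i)))

  sub-id : ∀ t → sub ix t ≡ t
  sub-exts-id : ∀ t → sub (exts ix) t ≡ t
  sub-id (ix i) = refl
  sub-id (so s) = refl
  sub-id (∏ U T) = cong₂ ∏ (sub-id U) (sub-exts-id T)
  sub-id (ƛ U t) = cong₂ ƛ (sub-id U) (sub-exts-id t)
  sub-id (t ∙ u) = cong₂ _∙_ (sub-id t) (sub-id u)
  sub-exts-id t = trans (sub-cong (λ { zero → refl ; (suc i) → refl }) t) (sub-id t)

  ren-id : ∀ t → ren id t ≡ t
  ren-id t = trans (ren≡sub id t) (sub-id t)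

  sub-sub≡ : ∀ {τ σ ρ} → (∀ i → sub τ (σ i) ≡ ρ i) → ∀ t → sub τ (sub σ t) ≡ sub ρ t
  sub-sub≡ {τ} {σ} eq t = trans (sub-sub τ σ t) (sub-cong eq t)

  -- Reduces a commutation of substitutions to a check on indices; many rules that propagate
  -- explicit substitutions become such checks.
  sub-sub-cong : ∀ {τ σ τ′ σ′} → (∀ i → sub τ (σ i) ≡ sub τ′ (σ′ i)) →
    ∀ t → sub τ (sub σ t) ≡ sub τ′ (sub σ′ t)
  sub-sub-cong {τ′ = τ′} {σ′} eq t = trans (sub-sub≡ eq t) (sym (sub-sub τ′ σ′ t))

  sub-◂-↑ : ∀ {u σ} t → sub (u ◂ σ) (↑ t) ≡ sub σ t
  sub-◂-↑ {u} {σ} t = sub-ren (u ◂ σ) suc t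

  sub-exts-↑ : ∀ σ t → sub (exts σ) (↑ t) ≡ ↑ sub σ t
  sub-exts-↑ σ t = trans (sub-ren (exts σ) suc t) (sym (ren-sub suc σ t))

  _⟨_⟩ : Tm → Tm → Tm
  t ⟨ u ⟩ = sub (u ◂ ix) t

  ↑-⟨⟩ : ∀ t {u} → (↑ t) ⟨ u ⟩ ≡ t
  ↑-⟨⟩ t = trans (sub-◂-↑ t) (sub-id t)

  sub-⟨⟩ : ∀ σ t u → sub σ (t ⟨ u ⟩) ≡ sub (exts σ) t ⟨ sub σ u ⟩
  sub-⟨⟩ σ t u = sub-sub-cong (λ { zero → refl ; (suc i) → sym (↑-⟨⟩ (σ i)) }) t

  ren-⟨⟩ : ∀ f t u → ren f (t ⟨ u ⟩) ≡ ren (lift f) t ⟨ ren f u ⟩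
  ren-⟨⟩ f t u = trans (ren-sub f _ t) (trans (sub-cong (λ { zero → refl ; (suc i) → refl }) t)
    (sym (sub-ren _ (lift f) t)))

  -- Conversion and typing of de Bruijn terms

  infix 4 _≅_
  -- Equivalence and congruence are generated together, so that stability under substitution is one
  -- induction. There is no α-constructor, since α-equivalent terms are equal here.
  data _≅_ : Tm → Tm → Set where
    ≅-refl  : ∀ {t} → t ≅ t
    ≅-sym   : ∀ {t u} → t ≅ u → u ≅ t
    ≅-trans : ∀ {t u v} → t ≅ u → u ≅ v → t ≅ v
    ≅-β     : ∀ {U t u} → ƛ U t ∙ u ≅ t ⟨ u ⟩
    ≅-∏     : ∀ {U U′ T T′} → U ≅ U′ → T ≅ T′ → ∏ U T ≅ ∏ U′ T′
    ≅-ƛ     : ∀ {U U′ t t′} → U ≅ U′ → t ≅ t′ → ƛ U t ≅ ƛ U′ t′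
    ≅-∙     : ∀ {t t′ u u′} → t ≅ t′ → u ≅ u′ → t ∙ u ≅ t′ ∙ u′

  ≅-reflexive : ∀ {t u} → t ≡ u → t ≅ u
  ≅-reflexive refl = ≅-refl

  ≅-sub : ∀ {t u} σ → t ≅ u → sub σ t ≅ sub σ u
  ≅-sub σ ≅-refl = ≅-refl
  ≅-sub σ (≅-sym p) = ≅-sym (≅-sub σ p)
  ≅-sub σ (≅-trans p q) = ≅-trans (≅-sub σ p) (≅-sub σ q)
  ≅-sub σ (≅-β {t = t} {u}) = ≅-trans ≅-β (≅-reflexive (sym (sub-⟨⟩ σ t u)))
  ≅-sub σ (≅-∏ p q) = ≅-∏ (≅-sub σ p) (≅-sub (exts σ) q)
  ≅-sub σ (≅-ƛ p q) = ≅-ƛ (≅-sub σ p) (≅-sub (exts σ) q)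
  ≅-sub σ (≅-∙ p q) = ≅-∙ (≅-sub σ p) (≅-sub σ q)

  ≅-ren : ∀ {t u} f → t ≅ u → ren f t ≅ ren f u
  ≅-ren {t} {u} f p = subst₂ _≅_ (sym (ren≡sub f t)) (sym (ren≡sub f u)) (≅-sub (ix ∘ f) p)

  sub-≅ : ∀ {σ τ} → (∀ i → σ i ≅ τ i) → ∀ t → sub σ t ≅ sub τ t
  sub-≅ σ≅τ (ix i) = σ≅τ i
  sub-≅ σ≅τ (so s) = ≅-refl
  sub-≅ σ≅τ (∏ U T) = ≅-∏ (sub-≅ σ≅τ U)
    (sub-≅ (λ { zero → ≅-refl ; (suc i) → ≅-ren suc (σ≅τ i) }) T)
  sub-≅ σ≅τ (ƛ U t) = ≅-ƛ (sub-≅ σ≅τ U)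
    (sub-≅ (λ { zero → ≅-refl ; (suc i) → ≅-ren suc (σ≅τ i) }) t)
  sub-≅ σ≅τ (t ∙ u) = ≅-∙ (sub-≅ σ≅τ t) (sub-≅ σ≅τ u)

  Ctx : Set₁
  Ctx = ℕ → Tm → Set

  infixl 5 _▸_
  -- The shifted types enter through equations, so that matching on a lookup never has to unify with
  -- `↑ U` and a lookup can be built with a type that is only provably a shift.
  data _▸_ (Γ : Ctx) (U : Tm) : Ctx where
    top : ∀ {T} → T ≡ ↑ U → (Γ ▸ U) zero T
    pop : ∀ {i T T′} → Γ i T → T′ ≡ ↑ T → (Γ ▸ U) (suc i) T′

  infix 4 _⊩_∶_

  -- Contexts are unordered, so well-formedness is replaced by the typing premise of d-ix.  The
  -- redundant premises of d-ix, d-ƛ and d-∙ make type correctness and the readback into the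
  -- named PTS plain structural inductions.
  data _⊩_∶_ (Γ : Ctx) : Tm → Tm → Set where
    d-ix   : ∀ {i T s} → Γ i T → Γ ⊩ T ∶ so s → Γ ⊩ ix i ∶ T
    d-so   : ∀ {s s′} → Ax s s′ → Γ ⊩ so s ∶ so s′
    d-∏    : ∀ {U T s₁ s₂ s₃} → Γ ⊩ U ∶ so s₁ → Γ ▸ U ⊩ T ∶ so s₂ → Rl s₁ s₂ s₃ → Γ ⊩ ∏ U T ∶ so s₃
    d-ƛ    : ∀ {U T t s₁ s} → Γ ⊩ U ∶ so s₁ → Γ ⊩ ∏ U T ∶ so s → Γ ▸ U ⊩ t ∶ T → Γ ⊩ ƛ U t ∶ ∏ U T
    d-∙    : ∀ {t u U T s₁ s₂} → Γ ⊩ U ∶ so s₁ → Γ ⊩ t ∶ ∏ U T → Γ ⊩ u ∶ U → Γ ⊩ T ⟨ u ⟩ ∶ so s₂ →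
             Γ ⊩ t ∙ u ∶ T ⟨ u ⟩
    d-conv : ∀ {t U V s} → Γ ⊩ t ∶ U → Γ ⊩ V ∶ so s → U ≅ V → Γ ⊩ t ∶ V

  type-correct : ∀ {Γ t T} → Γ ⊩ t ∶ T → (∃[ s ] T ≡ so s) ⊎ (∃[ s ] Γ ⊩ T ∶ so s)
  type-correct (d-ix _ T∶s) = inj₂ (_ , T∶s)
  type-correct (d-so _) = inj₁ (_ , refl)
  type-correct (d-∏ _ _ _) = inj₁ (_ , refl)
  type-correct (d-ƛ _ Π∶s _) = inj₂ (_ , Π∶s)
  type-correct (d-∙ _ _ _ T∶s) = inj₂ (_ , T∶s)
  type-correct (d-conv _ V∶s _) = inj₂ (_ , V∶s)

  ∏-inv : ∀ {Γ U T V} → Γ ⊩ ∏ U T ∶ V → (∃[ s ] Γ ⊩ U ∶ so s) × (∃[ s ] Γ ▸ U ⊩ T ∶ so s)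
  ∏-inv (d-∏ U∶s T∶s _) = (_ , U∶s) , (_ , T∶s)
  ∏-inv (d-conv d _ _) = ∏-inv d

  exts-lookup-on : ∀ {Γ : Ctx} {σ τ U} → (∀ {i T} → Γ i T → σ i ≡ τ i) →
    ∀ {i T} → (Γ ▸ U) i T → exts σ i ≡ exts τ i
  exts-lookup-on σ≗τ (top _) = refl
  exts-lookup-on σ≗τ (pop i∈ _) = cong ↑_ (σ≗τ i∈)

  -- The free indices of a typed term are all declared. This form of the scoping property later
  -- shows that acting on an undeclared name leaves a typed term alone.
  sub-typed : ∀ {Γ t T σ τ} → Γ ⊩ t ∶ T → (∀ {i T} → Γ i T → σ i ≡ τ i) → sub σ t ≡ sub τ t
  sub-typed (d-ix i∈ _) σ≗τ = σ≗τ i∈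
  sub-typed (d-so _) σ≗τ = refl
  sub-typed (d-∏ dU dT _) σ≗τ = cong₂ ∏ (sub-typed dU σ≗τ) (sub-typed dT (exts-lookup-on σ≗τ))
  sub-typed (d-ƛ dU _ dt) σ≗τ = cong₂ ƛ (sub-typed dU σ≗τ) (sub-typed dt (exts-lookup-on σ≗τ))
  sub-typed (d-∙ _ dt du _) σ≗τ = cong₂ _∙_ (sub-typed dt σ≗τ) (sub-typed du σ≗τ)
  sub-typed (d-conv d _ _) σ≗τ = sub-typed d σ≗τ

  Ren : (ℕ → ℕ) → Ctx → Ctx → Set
  Ren f Γ Δ = ∀ {i T} → Γ i T → Δ (f i) (ren f T)

  Ren-lift : ∀ {f Γ Δ U} → Ren f Γ Δ → Ren (lift f) (Γ ▸ U) (Δ ▸ ren f U)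
  Ren-lift {f} {U = U} r (top refl) = top (trans (ren-ren (lift f) suc U) (sym (ren-ren suc f U)))
  Ren-lift {f} r (pop {T = T} i∈ refl) =
    pop (r i∈) (trans (ren-ren (lift f) suc T) (sym (ren-ren suc f T)))

  ren-⊩ : ∀ {f Γ Δ t T} → Ren f Γ Δ → Γ ⊩ t ∶ T → Δ ⊩ ren f t ∶ ren f T
  ren-⊩ r (d-ix i∈ d) = d-ix (r i∈) (ren-⊩ r d)
  ren-⊩ r (d-so a) = d-so a
  ren-⊩ r (d-∏ dU dT ρ) = d-∏ (ren-⊩ r dU) (ren-⊩ (Ren-lift r) dT) ρ
  ren-⊩ r (d-ƛ dU dΠ dt) = d-ƛ (ren-⊩ r dU) (ren-⊩ r dΠ) (ren-⊩ (Ren-lift r) dt)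
  ren-⊩ {f} {Δ = Δ} r (d-∙ {t} {u} {T = T} {s₂ = s₂} dU dt du dT) =
    subst (Δ ⊩ _ ∶_) (sym (ren-⟨⟩ f T u))
      (d-∙ (ren-⊩ r dU) (ren-⊩ r dt) (ren-⊩ r du)
        (subst (Δ ⊩_∶ so s₂) (ren-⟨⟩ f T u) (ren-⊩ r dT)))
  ren-⊩ {f} r (d-conv d dV p) = d-conv (ren-⊩ r d) (ren-⊩ r dV) (≅-ren f p)

  ↑-⊩ : ∀ {Γ t T U} → Γ ⊩ t ∶ T → Γ ▸ U ⊩ ↑ t ∶ ↑ T
  ↑-⊩ = ren-⊩ λ i∈ → pop i∈ refl

  top-⊩ : ∀ {Γ U s} → Γ ⊩ U ∶ so s → Γ ▸ U ⊩ ix 0 ∶ ↑ U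
  top-⊩ dU = d-ix (top refl) (↑-⊩ dU)

  -- Asking for σ i to have the right type only up to ≅ makes substitution cover
  -- environment inclusion up to conversion as well.
  Sub : (ℕ → Tm) → Ctx → Ctx → Set
  Sub σ Γ Δ = ∀ {i T} → Γ i T → ∃[ U ] Δ ⊩ σ i ∶ U × U ≅ sub σ T

  Sub-exts : ∀ {σ Γ Δ U s} → Sub σ Γ Δ → Δ ⊩ sub σ U ∶ so s → Sub (exts σ) (Γ ▸ U) (Δ ▸ sub σ U)
  Sub-exts {σ} {U = U} h dU (top refl) = _ , top-⊩ dU , ≅-reflexive (sym (sub-exts-↑ σ U))
  Sub-exts {σ} h dU (pop {T = T} i∈ refl) with h i∈
  ... | V , d , p = ↑ V , ↑-⊩ d , ≅-trans (≅-ren suc p) (≅-reflexive (sym (sub-exts-↑ σ T)))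

  sub-⊩ : ∀ {σ Γ Δ t T} → Sub σ Γ Δ → Γ ⊩ t ∶ T → Δ ⊩ sub σ t ∶ sub σ T
  sub-⊩ h (d-ix i∈ d) with h i∈
  -- The type of `σ i` is right only up to `≅`; the typing premise of `d-ix`, after substitution,
  -- licenses the conversion.
  ... | V , dσi , p = d-conv dσi (sub-⊩ h d) p
  sub-⊩ h (d-so a) = d-so a
  sub-⊩ h (d-∏ dU dT ρ) = d-∏ (sub-⊩ h dU) (sub-⊩ (Sub-exts h (sub-⊩ h dU)) dT) ρ
  sub-⊩ h (d-ƛ dU dΠ dt) =
    d-ƛ (sub-⊩ h dU) (sub-⊩ h dΠ) (sub-⊩ (Sub-exts h (sub-⊩ h dU)) dt)
  sub-⊩ {σ} {Δ = Δ} h (d-∙ {t} {u} {T = T} {s₂ = s₂} dU dt du dT) =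
    subst (Δ ⊩ _ ∶_) (sym (sub-⟨⟩ σ T u))
      (d-∙ (sub-⊩ h dU) (sub-⊩ h dt) (sub-⊩ h du)
        (subst (Δ ⊩_∶ so s₂) (sub-⟨⟩ σ T u) (sub-⊩ h dT)))
  sub-⊩ {σ} h (d-conv d dV p) = d-conv (sub-⊩ h d) (sub-⊩ h dV) (≅-sub σ p)

  Sub-◂ : ∀ {σ Γ Δ u U} → Δ ⊩ u ∶ sub σ U → Sub σ Γ Δ → Sub (u ◂ σ) (Γ ▸ U) Δ
  Sub-◂ {U = U} du h (top refl) = _ , du , ≅-reflexive (sym (sub-◂-↑ U))
  Sub-◂ du h (pop {T = T} i∈ refl) with h i∈
  ... | V , d , p = V , d , ≅-trans p (≅-reflexive (sym (sub-◂-↑ T)))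

  -- Interpretation of PTSC terms

  infix 6 _↤_
  -- Substitution for a name: the other indices stay as they are, whereas `_⟨_⟩` eliminates index 0
  -- and lowers the rest.
  _↤_ : Var → Tm → ℕ → Tm
  x ↤ u = ix [ x ↦ u ]

  -- Links β-contraction of a closed body with substitution for a name; `B-rule` and the typing of
  -- `cons` both rest on it.
  close-↤ : ∀ x u t → ren (close x) t ⟨ u ⟩ ≡ sub (x ↤ u) t
  close-↤ x u t = trans (sub-ren _ (close x) t) (sub-cong pointwise t)
    where
    pointwise : ∀ w → (u ◂ ix) (close x w) ≡ (x ↤ u) w
    pointwise w with w ≡ᵇ x
    ... | true = refl
    ... | false = refl

  -- A list is read as a term whose index 0 is the hole for the head, names being shifted by one:
  -- ⟪ l ⟫ˡ with index 0 renamed to y is the paper's 𝓑ʸ(l).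
  ⟪_⟫ : Term → Tm
  ⟪_⟫ˡ : Lst → Tm
  ⟪ Pi x A B ⟫ = ∏ ⟪ A ⟫ (ren (close x) ⟪ B ⟫)
  ⟪ Lam x A M ⟫ = ƛ ⟪ A ⟫ (ren (close x) ⟪ M ⟫)
  ⟪ srt s ⟫ = so s
  ⟪ var x l ⟫ = ⟪ l ⟫ˡ ⟨ ix x ⟩
  ⟪ app M l ⟫ = ⟪ l ⟫ˡ ⟨ ⟪ M ⟫ ⟩
  ⟪ esub P x K M ⟫ = sub (x ↤ ⟪ P ⟫) ⟪ M ⟫
  ⟪ nil ⟫ˡ = ix 0
  ⟪ cons M l ⟫ˡ = sub (ix 0 ∙ ↑ ⟪ M ⟫ ◂ ix ∘ suc) ⟪ l ⟫ˡ
  ⟪ cat l l' ⟫ˡ = sub (⟪ l ⟫ˡ ◂ ix ∘ suc) ⟪ l' ⟫ˡ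
  ⟪ lsub P x K l ⟫ˡ = sub (exts (x ↤ ⟪ P ⟫)) ⟪ l ⟫ˡ

  -- Free names of interpreted terms

  ↤-on : ∀ {x u v σ τ xs} → sub σ u ≡ sub τ v → (∀ w → w ∈ del x xs → σ w ≡ τ w) →
    ∀ w → w ∈ xs → sub σ ((x ↤ u) w) ≡ sub τ ((x ↤ v) w)
  ↤-on {x} u≡v σ≗τ w w∈ with w ≟ x
  ... | yes refl rewrite ≡ᵇ-refl x = u≡v
  ... | no w≢x rewrite ≢⇒≡ᵇ-false w≢x = σ≗τ w (∈-del w∈ w≢x)

  close-exts-on : ∀ {x σ τ xs} → (∀ w → w ∈ del x xs → σ w ≡ τ w) →
    ∀ w → w ∈ xs → exts σ (close x w) ≡ exts τ (close x w)
  close-exts-on {x} σ≗τ w w∈ with w ≟ x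
  ... | yes refl rewrite ≡ᵇ-refl x = refl
  ... | no w≢x rewrite ≢⇒≡ᵇ-false w≢x = cong ↑_ (σ≗τ w (∈-del w∈ w≢x))

  -- Bounds the free indices of `⟪ M ⟫` by `fvT M`. Phrased through substitutions it goes by
  -- induction: applications and explicit substitutions are interpreted by substitutions, which
  -- `sub-sub` fuses with `σ` and `τ`.
  ⟪⟫-on : ∀ M {σ τ} → (∀ w → w ∈ fvT M → σ w ≡ τ w) → sub σ ⟪ M ⟫ ≡ sub τ ⟪ M ⟫
  ⟪⟫ˡ-on : ∀ l {σ τ} → σ 0 ≡ τ 0 → (∀ w → w ∈ fvL l → σ (suc w) ≡ τ (suc w)) →
    sub σ ⟪ l ⟫ˡ ≡ sub τ ⟪ l ⟫ˡ
  close-on : ∀ x M {σ τ} → (∀ w → w ∈ del x (fvT M) → σ w ≡ τ w) →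
    sub (exts σ) (ren (close x) ⟪ M ⟫) ≡ sub (exts τ) (ren (close x) ⟪ M ⟫)
  ⟪⟫-on (Pi x A B) σ≗τ = cong₂ ∏ (⟪⟫-on A λ w → σ≗τ w ∘ ∈-++⁺ˡ)
    (close-on x B λ w → σ≗τ w ∘ ∈-++⁺ʳ (fvT A))
  ⟪⟫-on (Lam x A M) σ≗τ = cong₂ ƛ (⟪⟫-on A λ w → σ≗τ w ∘ ∈-++⁺ˡ)
    (close-on x M λ w → σ≗τ w ∘ ∈-++⁺ʳ (fvT A))
  ⟪⟫-on (srt s) σ≗τ = refl
  ⟪⟫-on (var x l) {σ} {τ} σ≗τ = trans (sub-sub σ _ ⟪ l ⟫ˡ) (trans
    (⟪⟫ˡ-on l (σ≗τ x (here refl)) λ w → σ≗τ w ∘ there)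
    (sym (sub-sub τ _ ⟪ l ⟫ˡ)))
  ⟪⟫-on (app M l) {σ} {τ} σ≗τ = trans (sub-sub σ _ ⟪ l ⟫ˡ) (trans
    (⟪⟫ˡ-on l (⟪⟫-on M λ w → σ≗τ w ∘ ∈-++⁺ˡ) λ w → σ≗τ w ∘ ∈-++⁺ʳ (fvT M))
    (sym (sub-sub τ _ ⟪ l ⟫ˡ)))
  ⟪⟫-on (esub N x A M) {σ} {τ} σ≗τ = trans (sub-sub σ _ ⟪ M ⟫) (trans
    (⟪⟫-on M (↤-on (⟪⟫-on N λ w → σ≗τ w ∘ ∈-++⁺ˡ) λ w → σ≗τ w ∘ ∈-++⁺ʳ (fvT N) ∘ ∈-++⁺ʳ (fvT A)))
    (sym (sub-sub τ _ ⟪ M ⟫)))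
  ⟪⟫ˡ-on nil σ0≡τ0 σ≗τ = σ0≡τ0
  ⟪⟫ˡ-on (cons M l) {σ} {τ} σ0≡τ0 σ≗τ = trans (sub-sub σ _ ⟪ l ⟫ˡ) (trans
    (⟪⟫ˡ-on l
      (cong₂ _∙_ σ0≡τ0 (trans (sub-ren σ suc ⟪ M ⟫)
        (trans (⟪⟫-on M λ w → σ≗τ w ∘ ∈-++⁺ˡ) (sym (sub-ren τ suc ⟪ M ⟫)))))
      λ w → σ≗τ w ∘ ∈-++⁺ʳ (fvT M))
    (sym (sub-sub τ _ ⟪ l ⟫ˡ)))
  ⟪⟫ˡ-on (cat l l') {σ} {τ} σ0≡τ0 σ≗τ = trans (sub-sub σ _ ⟪ l' ⟫ˡ) (trans
    (⟪⟫ˡ-on l' (⟪⟫ˡ-on l σ0≡τ0 λ w → σ≗τ w ∘ ∈-++⁺ˡ) λ w → σ≗τ w ∘ ∈-++⁺ʳ (fvL l))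
    (sym (sub-sub τ _ ⟪ l' ⟫ˡ)))
  ⟪⟫ˡ-on (lsub N x A l) {σ} {τ} σ0≡τ0 σ≗τ = trans (sub-sub σ _ ⟪ l ⟫ˡ) (trans
    (⟪⟫ˡ-on l σ0≡τ0 λ w w∈ → trans (sub-ren σ suc ((x ↤ ⟪ N ⟫) w)) (trans
      (↤-on (⟪⟫-on N λ w → σ≗τ w ∘ ∈-++⁺ˡ) (λ w → σ≗τ w ∘ ∈-++⁺ʳ (fvT N) ∘ ∈-++⁺ʳ (fvT A)) w w∈)
      (sym (sub-ren τ suc ((x ↤ ⟪ N ⟫) w)))))
    (sym (sub-sub τ _ ⟪ l ⟫ˡ)))
  close-on x M {σ} {τ} σ≗τ = trans (sub-ren (exts σ) (close x) ⟪ M ⟫) (trans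
    (⟪⟫-on M (close-exts-on σ≗τ)) (sym (sub-ren (exts τ) (close x) ⟪ M ⟫)))

  ⟪⟫-ren-on : ∀ M {f g} → (∀ w → w ∈ fvT M → f w ≡ g w) → ren f ⟪ M ⟫ ≡ ren g ⟪ M ⟫
  ⟪⟫-ren-on M {f} {g} f≗g = trans (ren≡sub f ⟪ M ⟫)
    (trans (⟪⟫-on M λ w → cong ix ∘ f≗g w) (sym (ren≡sub g ⟪ M ⟫)))

  -- Swapping names

  close-swapv : ∀ x y v w → close (swapv x y v) (swapv x y w) ≡ lift (swapv x y) (close v w)
  close-swapv x y v w with w ≟ v
  ... | yes refl rewrite ≡ᵇ-refl w | ≡ᵇ-refl (swapv x y w) = refl
  ... | no w≢v rewrite ≢⇒≡ᵇ-false w≢v | ≢⇒≡ᵇ-false (w≢v ∘ swapv-injective x y) = refl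

  ↤-swapv : ∀ x y v u w → (swapv x y v ↤ ren (swapv x y) u) (swapv x y w) ≡ ren (swapv x y) ((v ↤ u) w)
  ↤-swapv x y v u w with w ≟ v
  ... | yes refl rewrite ≡ᵇ-refl w | ≡ᵇ-refl (swapv x y w) = refl
  ... | no w≢v rewrite ≢⇒≡ᵇ-false w≢v | ≢⇒≡ᵇ-false (w≢v ∘ swapv-injective x y) = refl

  sub-ren≡ : ∀ {σ f g τ} → (∀ i → σ (f i) ≡ ren g (τ i)) → ∀ t → sub σ (ren f t) ≡ ren g (sub τ t)
  sub-ren≡ {σ} {f} {g} {τ} eq t = trans (sub-ren σ f t) (trans (sub-cong eq t) (sym (ren-sub g τ t)))

  ren-close-swapv : ∀ x y v t →
    ren (close (swapv x y v)) (ren (swapv x y) t) ≡ ren (lift (swapv x y)) (ren (close v) t)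
  ren-close-swapv x y v t = trans (ren-ren _ _ t) (trans
    (trans (ren≡sub _ t) (trans (sub-cong (λ w → cong ix (close-swapv x y v w)) t) (sym (ren≡sub _ t))))
    (sym (ren-ren _ _ t)))

  -- A swap is injective on names, so it commutes with `close` and `↤` at every binder without any
  -- freshness condition.
  ⟪⟫-sw : ∀ x y M → ⟪ swT x y M ⟫ ≡ ren (swapv x y) ⟪ M ⟫
  ⟪⟫ˡ-sw : ∀ x y l → ⟪ swL x y l ⟫ˡ ≡ ren (lift (swapv x y)) ⟪ l ⟫ˡ
  ⟪⟫-sw x y (Pi v A B) = cong₂ ∏ (⟪⟫-sw x y A)
    (trans (cong (ren _) (⟪⟫-sw x y B)) (ren-close-swapv x y v ⟪ B ⟫))
  ⟪⟫-sw x y (Lam v A M) = cong₂ ƛ (⟪⟫-sw x y A)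
    (trans (cong (ren _) (⟪⟫-sw x y M)) (ren-close-swapv x y v ⟪ M ⟫))
  ⟪⟫-sw x y (srt s) = refl
  ⟪⟫-sw x y (var v l) = trans (cong (sub _) (⟪⟫ˡ-sw x y l))
    (sub-ren≡ (λ { zero → refl ; (suc i) → refl }) ⟪ l ⟫ˡ)
  ⟪⟫-sw x y (app M l) rewrite ⟪⟫-sw x y M | ⟪⟫ˡ-sw x y l =
    sub-ren≡ (λ { zero → refl ; (suc i) → refl }) ⟪ l ⟫ˡ
  ⟪⟫-sw x y (esub N v A M) rewrite ⟪⟫-sw x y N | ⟪⟫-sw x y M =
    sub-ren≡ (↤-swapv x y v ⟪ N ⟫) ⟪ M ⟫
  ⟪⟫ˡ-sw x y nil = refl
  ⟪⟫ˡ-sw x y (cons M l) rewrite ⟪⟫-sw x y M | ⟪⟫ˡ-sw x y l =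
    sub-ren≡ (λ { zero → cong (ix 0 ∙_) (trans (ren-ren _ _ ⟪ M ⟫) (sym (ren-ren _ _ ⟪ M ⟫)))
                ; (suc i) → refl }) ⟪ l ⟫ˡ
  ⟪⟫ˡ-sw x y (cat l l') rewrite ⟪⟫ˡ-sw x y l | ⟪⟫ˡ-sw x y l' =
    sub-ren≡ (λ { zero → refl ; (suc i) → refl }) ⟪ l' ⟫ˡ
  ⟪⟫ˡ-sw x y (lsub N v A l) rewrite ⟪⟫-sw x y N | ⟪⟫ˡ-sw x y l =
    sub-ren≡ (λ { zero → refl
                ; (suc w) → trans (cong ↑_ (↤-swapv x y v ⟪ N ⟫ w))
                    (trans (ren-ren _ _ ((v ↤ ⟪ N ⟫) w)) (sym (ren-ren _ _ ((v ↤ ⟪ N ⟫) w)))) }) ⟪ l ⟫ˡ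

  -- One induction on contexts serves twice: with `_≡_` for α-conversion and with `_≅_` for
  -- reduction. Stability under `ren` and in both arguments of `sub` is required because the
  -- interpretation is built from them.
  module Congruence (_∼_ : Tm → Tm → Set)
    (∼-refl : ∀ {t} → t ∼ t)
    (∼-∏ : ∀ {U U′ T T′} → U ∼ U′ → T ∼ T′ → ∏ U T ∼ ∏ U′ T′)
    (∼-ƛ : ∀ {U U′ t t′} → U ∼ U′ → t ∼ t′ → ƛ U t ∼ ƛ U′ t′)
    (∼-∙ : ∀ {t t′ u u′} → t ∼ t′ → u ∼ u′ → (t ∙ u) ∼ (t′ ∙ u′))
    (∼-ren : ∀ {t u} f → t ∼ u → ren f t ∼ ren f u)
    (∼-sub : ∀ {t u} σ → t ∼ u → sub σ t ∼ sub σ u)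
    (sub-∼ : ∀ {σ τ} → (∀ i → σ i ∼ τ i) → ∀ t → sub σ t ∼ sub τ t)
    {RT : Term → Term → Set} {RL : Lst → Lst → Set}
    (RT⇒∼ : ∀ {M N} → RT M N → ⟪ M ⟫ ∼ ⟪ N ⟫) (RL⇒∼ : ∀ {l l'} → RL l l' → ⟪ l ⟫ˡ ∼ ⟪ l' ⟫ˡ) where

    private
      ◂-∼ : ∀ {u v σ} → u ∼ v → ∀ i → (u ◂ σ) i ∼ (v ◂ σ) i
      ◂-∼ p zero = p
      ◂-∼ p (suc i) = ∼-refl

      ↤-∼ : ∀ {x u v} → u ∼ v → ∀ i → (x ↤ u) i ∼ (x ↤ v) i
      ↤-∼ {x} p i with i ≡ᵇ x
      ... | true = p
      ... | false = ∼-refl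

      exts-∼ : ∀ {σ τ} → (∀ i → σ i ∼ τ i) → ∀ i → exts σ i ∼ exts τ i
      exts-∼ p zero = ∼-refl
      exts-∼ p (suc i) = ∼-ren suc (p i)

    ⟪⟫-ctx : ∀ {M N} → CtxT RT RL M N → ⟪ M ⟫ ∼ ⟪ N ⟫
    ⟪⟫ˡ-ctx : ∀ {l l'} → CtxL RT RL l l' → ⟪ l ⟫ˡ ∼ ⟪ l' ⟫ˡ
    ⟪⟫-ctx (baseT r) = RT⇒∼ r
    ⟪⟫-ctx (Pi₁ c) = ∼-∏ (⟪⟫-ctx c) ∼-refl
    ⟪⟫-ctx (Pi₂ c) = ∼-∏ ∼-refl (∼-ren _ (⟪⟫-ctx c))
    ⟪⟫-ctx (Lam₁ c) = ∼-ƛ (⟪⟫-ctx c) ∼-refl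
    ⟪⟫-ctx (Lam₂ c) = ∼-ƛ ∼-refl (∼-ren _ (⟪⟫-ctx c))
    ⟪⟫-ctx (var₁ c) = ∼-sub _ (⟪⟫ˡ-ctx c)
    ⟪⟫-ctx (app₁ {l = l} c) = sub-∼ (◂-∼ (⟪⟫-ctx c)) ⟪ l ⟫ˡ
    ⟪⟫-ctx (app₂ c) = ∼-sub _ (⟪⟫ˡ-ctx c)
    ⟪⟫-ctx (esub₁ {M = M} c) = sub-∼ (↤-∼ (⟪⟫-ctx c)) ⟪ M ⟫
    ⟪⟫-ctx (esub₂ c) = ∼-refl
    ⟪⟫-ctx (esub₃ c) = ∼-sub _ (⟪⟫-ctx c)
    ⟪⟫ˡ-ctx (baseL r) = RL⇒∼ r
    ⟪⟫ˡ-ctx (cons₁ {l = l} c) = sub-∼ (◂-∼ (∼-∙ ∼-refl (∼-ren suc (⟪⟫-ctx c)))) ⟪ l ⟫ˡ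
    ⟪⟫ˡ-ctx (cons₂ c) = ∼-sub _ (⟪⟫ˡ-ctx c)
    ⟪⟫ˡ-ctx (cat₁ {l₂ = l₂} c) = sub-∼ (◂-∼ (⟪⟫ˡ-ctx c)) ⟪ l₂ ⟫ˡ
    ⟪⟫ˡ-ctx (cat₂ c) = ∼-sub _ (⟪⟫ˡ-ctx c)
    ⟪⟫ˡ-ctx (lsub₁ {l = l} c) = sub-∼ (exts-∼ (↤-∼ (⟪⟫-ctx c))) ⟪ l ⟫ˡ
    ⟪⟫ˡ-ctx (lsub₂ c) = ∼-refl
    ⟪⟫ˡ-ctx (lsub₃ c) = ∼-sub _ (⟪⟫ˡ-ctx c)

  -- Invariance under α-conversion

  swapv-close-on : ∀ x y {xs} → y ∉ xs → ∀ w → w ∈ xs → close x w ≡ close y (swapv x y w)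
  swapv-close-on x y y∉ w w∈ with w ≟ x
  ... | yes refl rewrite ≡ᵇ-refl w | ≡ᵇ-refl y = refl
  ... | no w≢x with w ≟ y
  ...   | yes refl = ⊥-elim (y∉ w∈)
  ...   | no w≢y rewrite ≢⇒≡ᵇ-false w≢x | ≢⇒≡ᵇ-false w≢y | ≢⇒≡ᵇ-false w≢y = refl

  ↤-swapv-on : ∀ x y u {xs} → y ∉ xs → ∀ w → w ∈ xs → (x ↤ u) w ≡ (y ↤ u) (swapv x y w)
  ↤-swapv-on x y u y∉ w w∈ with w ≟ x
  ... | yes refl rewrite ≡ᵇ-refl w | ≡ᵇ-refl y = refl
  ... | no w≢x with w ≟ y
  ...   | yes refl = ⊥-elim (y∉ w∈)
  ...   | no w≢y rewrite ≢⇒≡ᵇ-false w≢x | ≢⇒≡ᵇ-false w≢y | ≢⇒≡ᵇ-false w≢y = refl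

  -- On the free names of `M`, among which `y` does not occur, the swap acts as the renaming of `x`
  -- to `y`.
  close-αeq : ∀ x y M → y ∉ fvT M → ren (close x) ⟪ M ⟫ ≡ ren (close y) ⟪ swT x y M ⟫
  close-αeq x y M y∉ rewrite ⟪⟫-sw x y M =
    trans (⟪⟫-ren-on M (swapv-close-on x y y∉)) (sym (ren-ren (close y) _ ⟪ M ⟫))

  αT⇒≡ : ∀ {M N} → αT M N → ⟪ M ⟫ ≡ ⟪ N ⟫
  αT⇒≡ (αPi {x} {y} {A} {B} y∉) = cong (∏ ⟪ A ⟫) (close-αeq x y B y∉)
  αT⇒≡ (αLam {x} {y} {A} {M} y∉) = cong (ƛ ⟪ A ⟫) (close-αeq x y M y∉)
  αT⇒≡ (αesub {N} {x} {y} {A} {M} y∉) rewrite ⟪⟫-sw x y M =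
    trans (⟪⟫-on M (↤-swapv-on x y ⟪ N ⟫ y∉)) (sym (sub-ren _ _ ⟪ M ⟫))

  αL⇒≡ : ∀ {l l'} → αL l l' → ⟪ l ⟫ˡ ≡ ⟪ l' ⟫ˡ
  αL⇒≡ (αlsub {N} {x} {y} {A} {l} y∉) rewrite ⟪⟫ˡ-sw x y l =
    trans (⟪⟫ˡ-on l refl λ w w∈ → cong ↑_ (↤-swapv-on x y ⟪ N ⟫ y∉ w w∈)) (sym (sub-ren _ _ ⟪ l ⟫ˡ))

  open Congruence _≡_ refl (cong₂ ∏) (cong₂ ƛ) (cong₂ _∙_)
    (λ f → cong (ren f)) (λ σ → cong (sub σ)) sub-cong {αT} {αL} αT⇒≡ αL⇒≡
    renaming (⟪⟫-ctx to α⇒≡; ⟪⟫ˡ-ctx to αˡ⇒≡)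

  -- Reduction as conversion

  close-sub : ∀ {x y} P M → x ≢ y → x ∉ fvT P →
    sub (exts (y ↤ ⟪ P ⟫)) (ren (close x) ⟪ M ⟫) ≡ ren (close x) (sub (y ↤ ⟪ P ⟫) ⟪ M ⟫)
  close-sub {x} {y} P M x≢y x∉ = sub-ren≡ pointwise ⟪ M ⟫
    where
    pointwise : ∀ w → exts (y ↤ ⟪ P ⟫) (close x w) ≡ ren (close x) ((y ↤ ⟪ P ⟫) w)
    pointwise w with w ≟ x
    ... | yes refl rewrite ≡ᵇ-refl w | ≢⇒≡ᵇ-false x≢y | ≡ᵇ-refl w = refl
    ... | no w≢x rewrite ≢⇒≡ᵇ-false w≢x with w ≟ y
    ...   | yes refl rewrite ≡ᵇ-refl w =
      -- As `x` is not free in `P`, closing `x` shifts `P` just as moving it under the binder does: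
      -- no capture.
      ⟪⟫-ren-on P λ v v∈ → sym (↦-other {f = suc} λ { refl → x∉ v∈ })
    ...   | no w≢y rewrite ≢⇒≡ᵇ-false w≢y | ≢⇒≡ᵇ-false w≢x = refl

  -- Only `B-rule` is a β-step; every other rule is an identity between interpretations.
  redT⇒≅ : ∀ {M N} → redT M N → ⟪ M ⟫ ≅ ⟪ N ⟫
  redT⇒≅ (B-rule {x} {A} {M} {N} {l}) = ≅-trans
    (≅-reflexive (sub-sub _ _ ⟪ l ⟫ˡ))
    -- The redex is what fills the hole of `⟪ l ⟫ˡ`, so the β-step is made inside the substituted
    -- term.
    (sub-≅ (λ { zero → ≅-trans (≅-∙ ≅-refl (≅-reflexive (↑-⟨⟩ ⟪ N ⟫)))
                        (≅-trans ≅-β (≅-reflexive (close-↤ x ⟪ N ⟫ ⟪ M ⟫)))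
              ; (suc i) → ≅-refl }) ⟪ l ⟫ˡ)
  redT⇒≅ nil-T = ≅-refl
  redT⇒≅ (var-cat {l' = l'}) = ≅-reflexive
    (sym (sub-sub≡ (λ { zero → refl ; (suc i) → refl }) ⟪ l' ⟫ˡ))
  redT⇒≅ (app-cat {l' = l'}) = ≅-reflexive
    (sym (sub-sub≡ (λ { zero → refl ; (suc i) → refl }) ⟪ l' ⟫ˡ))
  redT⇒≅ (s-Lam {P} {M = M} x≢y x∉P _) = ≅-ƛ ≅-refl (≅-reflexive (close-sub P M x≢y x∉P))
  redT⇒≅ (s-varY {P} {y} {l = l}) = ≅-reflexive (sub-sub-cong
    (λ { zero → ↦-same {f = ix} y ; (suc w) → sym (↑-⟨⟩ ((y ↤ ⟪ P ⟫) w)) }) ⟪ l ⟫ˡ)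
  redT⇒≅ (s-varX {P} {y} {x = x} {l} x≢y) = ≅-reflexive (sub-sub-cong
    (λ { zero → ↦-other {f = ix} x≢y ; (suc w) → sym (↑-⟨⟩ ((y ↤ ⟪ P ⟫) w)) }) ⟪ l ⟫ˡ)
  redT⇒≅ (s-app {M = M} {l}) = ≅-reflexive (sub-⟨⟩ _ ⟪ l ⟫ˡ ⟪ M ⟫)
  redT⇒≅ (s-Pi {P} {B = B} x≢y x∉P _) = ≅-∏ ≅-refl (≅-reflexive (close-sub P B x≢y x∉P))
  redT⇒≅ s-srt = ≅-refl

  redL⇒≡ : ∀ {l l'} → redL l l' → ⟪ l ⟫ˡ ≡ ⟪ l' ⟫ˡ
  redL⇒≡ (cons-cat {M} {l'} {l}) = sym (sub-sub≡ (λ { zero → refl ; (suc i) → refl }) ⟪ l ⟫ˡ)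
  redL⇒≡ (nil-cat {l}) = trans (sub-cong (λ { zero → refl ; (suc i) → refl }) ⟪ l ⟫ˡ) (sub-id ⟪ l ⟫ˡ)
  redL⇒≡ (cat-cat {l'' = l''}) = sym (sub-sub≡ (λ { zero → refl ; (suc i) → refl }) ⟪ l'' ⟫ˡ)
  redL⇒≡ cat-nil = refl
  redL⇒≡ s-nil = refl
  redL⇒≡ (s-cons {P} {y} {M = M} {l}) = sub-sub-cong
    (λ { zero → cong (ix 0 ∙_) (sub-exts-↑ _ ⟪ M ⟫)
       ; (suc w) → trans (ren≡sub suc _) (sym (sub-◂-↑ ((y ↤ ⟪ P ⟫) w))) }) ⟪ l ⟫ˡ
  redL⇒≡ (s-cat {P} {y} {l' = l'}) = sub-sub-cong
    (λ { zero → refl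
       ; (suc w) → trans (ren≡sub suc _) (sym (sub-◂-↑ ((y ↤ ⟪ P ⟫) w))) }) ⟪ l' ⟫ˡ

  open Congruence _≅_ ≅-refl ≅-∏ ≅-ƛ ≅-∙ ≅-ren ≅-sub sub-≅ {redT} {redL} redT⇒≅ (≅-reflexive ∘ redL⇒≡)
    renaming (⟪⟫-ctx to red⇒≅) using ()

  ↔*⇒≅ : ∀ {A B} → A ↔* B → ⟪ A ⟫ ≅ ⟪ B ⟫
  ↔*⇒≅ = Eq.gfold ≅-isEquivalence ⟪_⟫ step
    where
    ≅-isEquivalence : IsEquivalence _≅_
    ≅-isEquivalence = record { refl = ≅-refl ; sym = ≅-sym ; trans = ≅-trans }

    step : ∀ {A B} → (A ⟶ B) ⊎ CtxT αT αL A B → ⟪ A ⟫ ≅ ⟪ B ⟫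
    step (inj₁ r) = red⇒≅ r
    step (inj₂ a) = ≅-reflexive (α⇒≡ a)

  ≈α⇒≡ : ∀ {M N} → M ≈α N → ⟪ M ⟫ ≡ ⟪ N ⟫
  ≈α⇒≡ = Eq.gfold isEquivalence ⟪_⟫ α⇒≡

  ≈αₗ⇒≡ : ∀ {l l'} → l ≈αₗ l' → ⟪ l ⟫ˡ ≡ ⟪ l' ⟫ˡ
  ≈αₗ⇒≡ = Eq.gfold isEquivalence ⟪_⟫ˡ αˡ⇒≡

  -- Soundness of PTSC typing

  data ⌊_⌋ (Γ : Env) : Ctx where
    entry : ∀ {x A T} → (x , A) ∈ Γ → T ≡ ⟪ A ⟫ → ⌊ Γ ⌋ x T

  -- Well-formedness stated at every position of the environment, so that declarations in the middle
  -- are as accessible as the last one.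
  WF : Env → Set
  WF Γ = ∀ {Γ₁ x A Γ₂} → Γ ≡ Γ₁ ++ (x , A) ∷ Γ₂ → x ∉ dom Γ₁ × ∃[ s ] ⌊ Γ₁ ⌋ ⊩ ⟪ A ⟫ ∶ so s

  WF-prefix : ∀ {Γ Δ} → WF (Γ ++ Δ) → WF Γ
  WF-prefix {Δ = Δ} ω {Γ₁} {Γ₂ = Γ₂} refl = ω (++-assoc Γ₁ (_ ∷ Γ₂) Δ)

  WF-snoc : ∀ {Γ x A s} → WF Γ → x ∉ dom Γ → ⌊ Γ ⌋ ⊩ ⟪ A ⟫ ∶ so s → WF (Γ ,, x ∶ A)
  WF-snoc {Γ} ω x∉ dA {Γ₁} {Γ₂ = Γ₂} eq with initLast Γ₂
  WF-snoc {Γ} ω x∉ dA {Γ₁} eq | [] with ∷ʳ-injective Γ Γ₁ eq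
  ... | refl , refl = x∉ , _ , dA
  WF-snoc {Γ} ω x∉ dA {Γ₁} eq | Γ₂′ ∷ʳ′ _ =
    ω (∷ʳ-injectiveˡ Γ (Γ₁ ++ _ ∷ Γ₂′) (trans eq (sym (++-assoc Γ₁ (_ ∷ Γ₂′) _))))

  ⌊⌋-++ˡ : ∀ {Γ Δ t T} → ⌊ Γ ⌋ ⊩ t ∶ T → ⌊ Γ ++ Δ ⌋ ⊩ t ∶ T
  ⌊⌋-++ˡ {Γ} {Δ} {t} {T} d = subst₂ (⌊ Γ ++ Δ ⌋ ⊩_∶_) (ren-id t) (ren-id T)
    (ren-⊩ (λ { (entry ∈Γ refl) → entry (∈-++⁺ˡ ∈Γ) (ren-id _) }) d)

  WF-lookup : ∀ {Γ x A} → WF Γ → (x , A) ∈ Γ → ∃[ s ] ⌊ Γ ⌋ ⊩ ⟪ A ⟫ ∶ so s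
  WF-lookup ω x∈ with ∈-∃++ x∈
  ... | _ , _ , refl = _ , ⌊⌋-++ˡ (proj₂ (proj₂ (ω refl)))

  ∉-dom⇒≢ : ∀ {Γ : Env} {x y A} → x ∉ dom Γ → (y , A) ∈ Γ → y ≢ x
  ∉-dom⇒≢ x∉ y∈ refl = x∉ (∈-map⁺ proj₁ y∈)

  ↤-⌊⌋ : ∀ {Γ x u t T} → x ∉ dom Γ → ⌊ Γ ⌋ ⊩ t ∶ T → sub (x ↤ u) t ≡ t
  ↤-⌊⌋ {t = t} x∉ d = trans (sub-typed d λ { (entry y∈ _) → ↦-other {f = ix} (∉-dom⇒≢ x∉ y∈) }) (sub-id t)

  ren-close-⌊⌋ : ∀ {Γ x t T} → x ∉ dom Γ → ⌊ Γ ⌋ ⊩ t ∶ T → ren (close x) t ≡ ↑ t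
  ren-close-⌊⌋ {t = t} x∉ d = trans (ren≡sub _ t) (trans
    (sub-typed d λ { (entry y∈ _) → cong ix (↦-other {f = suc} (∉-dom⇒≢ x∉ y∈)) }) (sym (ren≡sub suc t)))

  -- Trades the last named declaration for a nameless one. All types involved are typed in `Γ`,
  -- which does not declare `x`, so closing `x` merely shifts them.
  Ren-close : ∀ {Γ x A} → WF (Γ ,, x ∶ A) → Ren (close x) ⌊ Γ ,, x ∶ A ⌋ (⌊ Γ ⌋ ▸ ⟪ A ⟫)
  Ren-close {Γ} {x} {A} ω (entry {y} y∈ refl) with ω {Γ₁ = Γ} refl | ∈-++⁻ Γ y∈
  ... | x∉ , _ , dA | inj₁ y∈Γ rewrite ≢⇒≡ᵇ-false (∉-dom⇒≢ x∉ y∈Γ) =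
    pop (entry y∈Γ refl) (ren-close-⌊⌋ x∉ (proj₂ (WF-lookup (WF-prefix ω) y∈Γ)))
  ... | x∉ , _ , dA | inj₂ (here refl) rewrite ≡ᵇ-refl x = top (ren-close-⌊⌋ x∉ dA)

  ⊩-close : ∀ {Γ x A t T} → WF (Γ ,, x ∶ A) → ⌊ Γ ,, x ∶ A ⌋ ⊩ t ∶ T →
    ⌊ Γ ⌋ ▸ ⟪ A ⟫ ⊩ ren (close x) t ∶ ren (close x) T
  ⊩-close ω = ren-⊩ (Ren-close ω)

  ⊑-lookup : ∀ {Γ Δ y B} → WF Δ → Γ ⊑ Δ → (y , B) ∈ Γ → ∃[ U ] ⌊ Δ ⌋ ⊩ ix y ∶ U × U ≅ ⟪ B ⟫
  ⊑-lookup ω Γ⊑Δ y∈ with Γ⊑Δ y∈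
  ... | B′ , y∈Δ , B↔B′ = _ , d-ix (entry y∈Δ refl) (proj₂ (WF-lookup ω y∈Δ)) , ≅-sym (↔*⇒≅ B↔B′)

  -- An instance of `sub-⊩` at the identity, where each name has in `Δ` a type convertible to its
  -- type in `Γ`.
  ⊑-weaken : ∀ {Γ Δ t T} → WF Δ → Γ ⊑ Δ → ⌊ Γ ⌋ ⊩ t ∶ T → ⌊ Δ ⌋ ⊩ t ∶ T
  ⊑-weaken {Γ} {Δ} {t} {T} ω Γ⊑Δ d = subst₂ (⌊ Δ ⌋ ⊩_∶_) (sub-id t) (sub-id T) (sub-⊩ inclusion d)
    where
    inclusion : Sub ix ⌊ Γ ⌋ ⌊ Δ ⌋
    inclusion (entry {A = B} y∈ refl) with ⊑-lookup ω Γ⊑Δ y∈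
    ... | U , d , p = U , d , ≅-trans p (≅-reflexive (sym (sub-id ⟪ B ⟫)))

  -- Names of `Δ` have their substituted types in `substEnv P x A Δ`. The types of `x` and of the
  -- names of `Γ` are typed in `Γ`, so the substitution fixes them.
  Sub-↤ : ∀ {Γ x A Δ Δ' P} → WF ((Γ ,, x ∶ A) ++ Δ) → WF Δ' → (Γ ++ substEnv P x A Δ) ⊑ Δ' →
    ⌊ Γ ⌋ ⊩ ⟪ P ⟫ ∶ ⟪ A ⟫ → Sub (x ↤ ⟪ P ⟫) ⌊ (Γ ,, x ∶ A) ++ Δ ⌋ ⌊ Δ' ⌋
  Sub-↤ {Γ} {x} {A} {Δ} {Δ'} {P} ω ω′ sq dP (entry {y} {B} y∈ refl)
    with WF-prefix {Γ = Γ ,, x ∶ A} ω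
  ... | ωx with ωx {Γ₁ = Γ} refl | ∈-++⁻ (Γ ,, x ∶ A) y∈
  ... | x∉ , _ , dA | inj₂ y∈Δ with ∈-∃++ y∈Δ
  ...   | Δ₁ , Δ₂ , refl =
    U , subst (⌊ Δ' ⌋ ⊩_∶ U) (sym (↦-other {f = ix} y≢x)) (proj₁ (proj₂ look)) , proj₂ (proj₂ look)
    where
    look = ⊑-lookup {B = esub P x A B} ω′ sq (∈-++⁺ʳ Γ (∈-map⁺ _ y∈Δ))
    U = proj₁ look
    y≢x : y ≢ x
    -- Well-formedness forbids `Δ` to declare `x` again.
    y≢x refl = proj₁ (ω (sym (++-assoc (Γ ,, x ∶ A) Δ₁ _)))
      (∈-map⁺ proj₁ (∈-++⁺ˡ (∈-++⁺ʳ Γ (here refl))))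
  Sub-↤ {Γ} {x} {A} {Δ} {Δ'} {P} ω ω′ sq dP (entry {y} {B} y∈ refl) | ωx
    | x∉ , _ , dA | inj₁ y∈Γx with ∈-++⁻ Γ y∈Γx
  ... | inj₂ (here refl) = _ ,
    subst (⌊ Δ' ⌋ ⊩_∶ ⟪ A ⟫) (sym (↦-same {f = ix} x)) (⊑-weaken ω′ (sq ∘ ∈-++⁺ˡ) dP) ,
    ≅-reflexive (sym (↤-⌊⌋ x∉ dA))
  ... | inj₁ y∈Γ with ⊑-lookup ω′ sq (∈-++⁺ˡ y∈Γ) | WF-lookup (WF-prefix ωx) y∈Γ
  ...   | U , d , p | _ , dB = U , subst (⌊ Δ' ⌋ ⊩_∶ U) (sym (↦-other {f = ix} (∉-dom⇒≢ x∉ y∈Γ))) d ,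
    ≅-trans p (≅-reflexive (sym (↤-⌊⌋ x∉ dB)))

  -- The special case for sorts disappears, because substitution fixes a sort.
  ⟪substTy⟫ : ∀ P x A C → ⟪ substTy P x A C ⟫ ≡ sub (x ↤ ⟪ P ⟫) ⟪ C ⟫
  ⟪substTy⟫ P x A (Pi _ _ _) = refl
  ⟪substTy⟫ P x A (Lam _ _ _) = refl
  ⟪substTy⟫ P x A (srt _) = refl
  ⟪substTy⟫ P x A (var _ _) = refl
  ⟪substTy⟫ P x A (app _ _) = refl
  ⟪substTy⟫ P x A (esub _ _ _ _) = refl

  -- Filling the hole of a list

  Sub-↑ : ∀ {Γ U} → WF Γ → Sub (ix ∘ suc) ⌊ Γ ⌋ (⌊ Γ ⌋ ▸ U)
  Sub-↑ ω (entry {A = A} y∈ refl) =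
    _ , ↑-⊩ (d-ix (entry y∈ refl) (proj₂ (WF-lookup ω y∈))) , ≅-reflexive (ren≡sub suc ⟪ A ⟫)

  Sub-ix : ∀ {Γ} → WF Γ → Sub ix ⌊ Γ ⌋ ⌊ Γ ⌋
  Sub-ix ω (entry {A = A} y∈ refl) =
    _ , d-ix (entry y∈ refl) (proj₂ (WF-lookup ω y∈)) , ≅-reflexive (sym (sub-id ⟪ A ⟫))

  plug : ∀ {Γ u U t T} → WF Γ → ⌊ Γ ⌋ ⊩ u ∶ U → ⌊ Γ ⌋ ▸ U ⊩ t ∶ T → ⌊ Γ ⌋ ⊩ t ⟨ u ⟩ ∶ T ⟨ u ⟩
  plug {Γ} {u} {U} ω du = sub-⊩ (Sub-◂ (subst (⌊ Γ ⌋ ⊩ u ∶_) (sym (sub-id U)) du) (Sub-ix ω))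

  plug-↑ : ∀ {Γ u U t T} → WF Γ → ⌊ Γ ⌋ ⊩ u ∶ U → ⌊ Γ ⌋ ▸ U ⊩ t ∶ ↑ T → ⌊ Γ ⌋ ⊩ t ⟨ u ⟩ ∶ T
  plug-↑ {Γ} {u} {t = t} {T} ω du dt = subst (⌊ Γ ⌋ ⊩ t ⟨ u ⟩ ∶_) (↑-⟨⟩ T) (plug ω du dt)

  -- The common shape of `l-cons`, `l-cat` and `l-convL`: a hole is filled by a term that has a hole
  -- itself.
  extend : ∀ {Γ u U V t T} → WF Γ → ⌊ Γ ⌋ ▸ V ⊩ u ∶ ↑ U → ⌊ Γ ⌋ ▸ U ⊩ t ∶ ↑ T →
    ⌊ Γ ⌋ ▸ V ⊩ sub (u ◂ ix ∘ suc) t ∶ ↑ T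
  extend {Γ} {u} {U} {V} {t} {T} ω du dt = subst (⌊ Γ ⌋ ▸ V ⊩ _ ∶_)
    (trans (sub-◂-↑ T) (sym (ren≡sub suc T)))
    (sub-⊩ (Sub-◂ (subst (⌊ Γ ⌋ ▸ V ⊩ u ∶_) (ren≡sub suc U) du) (Sub-↑ ω)) dt)

  -- `WF Γ` is carried along for lookup and closing. A list also yields a typing of its head type,
  -- which supplies premises of `d-ix`, `d-∙` and `d-conv`.
  sound : ∀ {Γ M A} → Γ ⊢ M ∶ A → WF Γ × ⌊ Γ ⌋ ⊩ ⟪ M ⟫ ∶ ⟪ A ⟫
  soundˡ : ∀ {Γ B l C} → Γ ⍮ B ⊢ l ∶ C →
    WF Γ × (∃[ s ] ⌊ Γ ⌋ ⊩ ⟪ B ⟫ ∶ so s) × ⌊ Γ ⌋ ▸ ⟪ B ⟫ ⊩ ⟪ l ⟫ˡ ∶ ↑ ⟪ C ⟫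
  sound-wf : ∀ {Γ} → Γ wf → WF Γ
  sound (t-srt ω a) = sound-wf ω , d-so a
  sound (t-Pi dA dB ρ) with sound dA | sound dB
  ... | ω , dA′ | ωx , dB′ = ω , d-∏ dA′ (⊩-close ωx dB′) ρ
  sound (t-Lam dΠ dM) with sound dΠ | sound dM
  ... | ω , dΠ′ | ωx , dM′ = ω , d-ƛ (proj₂ (proj₁ (∏-inv dΠ′))) dΠ′ (⊩-close ωx dM′)
  sound (t-var dl x∈) with soundˡ dl
  ... | ω , (_ , dA) , dl′ = ω , plug-↑ ω (d-ix (entry x∈ refl) dA) dl′
  sound (t-conv dM dB p) with sound dM | sound dB
  ... | ω , dM′ | _ , dB′ = ω , d-conv dM′ dB′ (↔*⇒≅ p)
  sound (t-app dM dl) with sound dM | soundˡ dl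
  ... | ω , dM′ | _ , _ , dl′ = ω , plug-↑ ω dM′ dl′
  sound (t-esub {Δ' = Δ'} {P} {x} {A} {M} {C} dP dM sq ω′) with sound dP | sound dM
  ... | _ , dP′ | ω , dM′ = sound-wf ω′ ,
    subst (⌊ Δ' ⌋ ⊩ ⟪ esub P x A M ⟫ ∶_) (sym (⟪substTy⟫ P x A C))
      (sub-⊩ (Sub-↤ ω (sound-wf ω′) sq dP′) dM′)
  sound (t-α {Γ} {A = A} dM p) with sound dM
  ... | ω , dM′ = ω , subst (⌊ Γ ⌋ ⊩_∶ ⟪ A ⟫) (≈α⇒≡ p) dM′
  soundˡ (l-nil dA) with sound dA
  ... | ω , dA′ = ω , (_ , dA′) , top-⊩ dA′
  soundˡ (l-cons {Γ} {x} {A} {B} {M} {l} {C} dΠ dM dl) with sound dΠ | sound dM | soundˡ dl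
  ... | ω , dΠ′ | _ , dM′ | _ , (_ , dB) , dl′ with ∏-inv dΠ′
  ...   | (_ , dA) , _ = ω , (_ , dΠ′) , extend ω
    -- The hole of `l` receives the new hole applied to `M`.
    (subst (⌊ Γ ⌋ ▸ ⟪ Pi x A B ⟫ ⊩ ix 0 ∙ ↑ ⟪ M ⟫ ∶_) type≡
      (d-∙ (↑-⊩ dA) (top-⊩ dΠ′) (↑-⊩ dM′)
        (subst (⌊ Γ ⌋ ▸ ⟪ Pi x A B ⟫ ⊩_∶ so _) (sym type≡) (↑-⊩ dB))))
    dl′
    where
    type≡ : ren (lift suc) (ren (close x) ⟪ B ⟫) ⟨ ↑ ⟪ M ⟫ ⟩ ≡ ↑ ⟪ esub M x A B ⟫
    type≡ = trans (sym (ren-⟨⟩ suc (ren (close x) ⟪ B ⟫) ⟪ M ⟫)) (cong ↑_ (close-↤ x ⟪ M ⟫ ⟪ B ⟫))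
  soundˡ (l-convR dl dB p) with soundˡ dl | sound dB
  ... | ω , dC , dl′ | _ , dB′ = ω , dC , d-conv dl′ (↑-⊩ dB′) (≅-ren suc (↔*⇒≅ p))
  soundˡ (l-convL {Γ} {A} {l} {C} {B} dl dB p) with soundˡ dl | sound dB
  ... | ω , (_ , dA) , dl′ | _ , dB′ = ω , (_ , dB′) ,
    -- The term does not change: its hole is filled by itself, declared with type `B` and converted
    -- to `A`.
    subst (⌊ Γ ⌋ ▸ ⟪ B ⟫ ⊩_∶ ↑ ⟪ C ⟫)
      (trans (sub-cong (λ { zero → refl ; (suc i) → refl }) ⟪ l ⟫ˡ) (sub-id ⟪ l ⟫ˡ))
      (extend ω (d-conv (top-⊩ dB′) (↑-⊩ dA) (≅-ren suc (≅-sym (↔*⇒≅ p)))) dl′)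
  soundˡ (l-cat dl' dl) with soundˡ dl' | soundˡ dl
  ... | ω , dC , dl'′ | _ , _ , dl′ = ω , dC , extend ω dl'′ dl′
  soundˡ (l-lsub {Δ' = Δ'} {C = C} dP dl sq ω′) with sound dP | soundˡ dl
  ... | _ , dP′ | ω , (_ , dB) , dl′ = sound-wf ω′ , (_ , sub-⊩ h dB) ,
    subst (⌊ Δ' ⌋ ▸ _ ⊩ _ ∶_) (sub-exts-↑ _ ⟪ C ⟫) (sub-⊩ (Sub-exts h (sub-⊩ h dB)) dl′)
    where h = Sub-↤ ω (sound-wf ω′) sq dP′
  soundˡ (l-α {Γ} {B} {C = C} dl p) with soundˡ dl
  ... | ω , dB , dl′ = ω , dB , subst (⌊ Γ ⌋ ▸ ⟪ B ⟫ ⊩_∶ ↑ ⟪ C ⟫) (≈αₗ⇒≡ p) dl′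
  sound-wf wf-∅ {Γ₁ = []} ()
  sound-wf wf-∅ {Γ₁ = _ ∷ _} ()
  sound-wf (wf-, dA x∉) with sound dA
  ... | ω , dA′ = WF-snoc ω x∉ dA′

  -- Named and de Bruijn PTS terms

  ⌈_⌉ : PTerm → Tm
  ⌈ pv x ⌉ = ix x
  ⌈ ps s ⌉ = so s
  ⌈ pΠ x T t ⌉ = ∏ ⌈ T ⌉ (ren (close x) ⌈ t ⌉)
  ⌈ pλ x T t ⌉ = ƛ ⌈ T ⌉ (ren (close x) ⌈ t ⌉)
  ⌈ t · u ⌉ = ⌈ t ⌉ ∙ ⌈ u ⌉

  fv-⌈⌉ : ∀ t → fv ⌈ t ⌉ ≡ fvP t
  fv-close : ∀ x t → down (fv (ren (close x) ⌈ t ⌉)) ≡ del x (fvP t)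
  fv-⌈⌉ (pv x) = refl
  fv-⌈⌉ (ps s) = refl
  fv-⌈⌉ (pΠ x T t) = cong₂ _++_ (fv-⌈⌉ T) (fv-close x t)
  fv-⌈⌉ (pλ x T t) = cong₂ _++_ (fv-⌈⌉ T) (fv-close x t)
  fv-⌈⌉ (t · u) = cong₂ _++_ (fv-⌈⌉ t) (fv-⌈⌉ u)
  fv-close x t = trans (cong down (trans (fv-ren (close x) ⌈ t ⌉) (cong (map (close x)) (fv-⌈⌉ t))))
    (down-close x (fvP t))

  ⌈⌉-on : ∀ t {σ τ} → (∀ w → w ∈ fvP t → σ w ≡ τ w) → sub σ ⌈ t ⌉ ≡ sub τ ⌈ t ⌉
  ⌈⌉-on t σ≗τ = sub-on ⌈ t ⌉ λ w w∈ → σ≗τ w (subst (w ∈_) (fv-⌈⌉ t) w∈)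

  ren-on : ∀ {f g} t → (∀ i → i ∈ fv t → f i ≡ g i) → ren f t ≡ ren g t
  ren-on {f} {g} t f≗g = trans (ren≡sub f t)
    (trans (sub-on t λ i → cong ix ∘ f≗g i) (sym (ren≡sub g t)))

  ⌈⌉-ren-on : ∀ t {f g} → (∀ w → w ∈ fvP t → f w ≡ g w) → ren f ⌈ t ⌉ ≡ ren g ⌈ t ⌉
  ⌈⌉-ren-on t f≗g = ren-on ⌈ t ⌉ λ w w∈ → f≗g w (subst (w ∈_) (fv-⌈⌉ t) w∈)

  ⌈sw⌉ : ∀ x y t → ⌈ swP x y t ⌉ ≡ ren (swapv x y) ⌈ t ⌉
  ⌈sw⌉ x y (pv v) = refl
  ⌈sw⌉ x y (ps s) = refl
  ⌈sw⌉ x y (pΠ v T t) = cong₂ ∏ (⌈sw⌉ x y T)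
    (trans (cong (ren _) (⌈sw⌉ x y t)) (ren-close-swapv x y v ⌈ t ⌉))
  ⌈sw⌉ x y (pλ v T t) = cong₂ ƛ (⌈sw⌉ x y T)
    (trans (cong (ren _) (⌈sw⌉ x y t)) (ren-close-swapv x y v ⌈ t ⌉))
  ⌈sw⌉ x y (t · u) = cong₂ _∙_ (⌈sw⌉ x y t) (⌈sw⌉ x y u)

  -- Capture avoidance: `z` occurs in no image of another free name, so closing `z` shifts all those
  -- images.
  ⌈upd⌉-close : ∀ σ x z t → (∀ w → w ∈ del x (fvP t) → z ∉ fvP (σ w)) →
    ren (close z) (sub (⌈_⌉ ∘ upd σ x (pv z)) ⌈ t ⌉) ≡ sub (exts (⌈_⌉ ∘ σ)) (ren (close x) ⌈ t ⌉)
  ⌈upd⌉-close σ x z t z∉ = trans (ren-sub _ _ ⌈ t ⌉)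
    (trans (⌈⌉-on t pointwise) (sym (sub-ren _ _ ⌈ t ⌉)))
    where
    pointwise : ∀ w → w ∈ fvP t → ren (close z) ⌈ upd σ x (pv z) w ⌉ ≡ exts (⌈_⌉ ∘ σ) (close x w)
    pointwise w w∈ with w ≟ x
    ... | yes refl rewrite ≡ᵇ-refl w = cong ix (↦-same {f = suc} z)
    ... | no w≢x rewrite ≢⇒≡ᵇ-false w≢x = ⌈⌉-ren-on (σ w) λ v v∈ →
      ↦-other {f = suc} λ { refl → z∉ w (∈-del w∈ w≢x) v∈ }

  freshFrom-concatMap : ∀ (f : Var → List Var) xs {w} → w ∈ xs → freshFrom (concatMap f xs) ∉ f w
  freshFrom-concatMap f xs w∈ z∈ =
    freshFrom-∉ (concatMap f xs) (∈-concatMap⁺ f (lose w∈ z∈))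

  ⌈ssub⌉ : ∀ σ t → ⌈ ssub σ t ⌉ ≡ sub (⌈_⌉ ∘ σ) ⌈ t ⌉
  ⌈ssub⌉ σ (pv x) = refl
  ⌈ssub⌉ σ (ps s) = refl
  ⌈ssub⌉ σ (pΠ x T t) = cong₂ ∏ (⌈ssub⌉ σ T) (trans (cong (ren _) (⌈ssub⌉ _ t))
    (⌈upd⌉-close σ x _ t λ w w∈ → freshFrom-concatMap (fvP ∘ σ) _ (∈-++⁺ʳ (fvP T) w∈)))
  ⌈ssub⌉ σ (pλ x T t) = cong₂ ƛ (⌈ssub⌉ σ T) (trans (cong (ren _) (⌈ssub⌉ _ t))
    (⌈upd⌉-close σ x _ t λ w w∈ → freshFrom-concatMap (fvP ∘ σ) _ (∈-++⁺ʳ (fvP T) w∈)))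
  ⌈ssub⌉ σ (t · u) = cong₂ _∙_ (⌈ssub⌉ σ t) (⌈ssub⌉ σ u)

  ⌈≔⌉ : ∀ t x u → ⌈ t [ x ≔ u ] ⌉ ≡ sub (x ↤ ⌈ u ⌉) ⌈ t ⌉
  ⌈≔⌉ t x u = trans (⌈ssub⌉ _ t) (sub-cong pointwise ⌈ t ⌉)
    where
    pointwise : ∀ w → ⌈ upd pv x u w ⌉ ≡ (x ↤ ⌈ u ⌉) w
    pointwise w with w ≡ᵇ x
    ... | true = refl
    ... | false = refl

  -- Readback of terms and completeness of α-equivalence

  rd : Tm → (ℕ → Var) → PTerm
  rd (ix i) η = pv (η i)
  rd (so s) η = ps s
  rd (∏ U T) η = let z = freshFrom (map η (fv (∏ U T))) in pΠ z (rd U η) (rd T (z ◂ η))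
  rd (ƛ U t) η = let z = freshFrom (map η (fv (ƛ U t))) in pλ z (rd U η) (rd t (z ◂ η))
  rd (t ∙ u) η = rd t η · rd u η

  close-◂ : ∀ {z η} t → z ∉ map η (down (fv t)) → ren (close z) (ren (z ◂ η) t) ≡ ren (lift η) t
  close-◂ {z} {η} t z∉ = trans (ren-ren _ _ t) (ren-on t λ
    { zero _ → ↦-same {f = suc} z
    ; (suc i) i∈ → ↦-other {f = suc} λ { refl → z∉ (∈-map⁺ η (∈-down i∈)) } })

  freshFrom-binder : ∀ η U T → freshFrom (map η (fv U ++ down (fv T))) ∉ map η (down (fv T))
  freshFrom-binder η U T z∈ = freshFrom-∉ _
    (subst (freshFrom (map η (fv U ++ down (fv T))) ∈_) (sym (map-++ η (fv U) (down (fv T))))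
      (∈-++⁺ʳ (map η (fv U)) z∈))

  -- Holds for every `η`, injective or not, because a binder name avoids the names given to the free
  -- indices that actually occur.
  ⌈rd⌉ : ∀ t η → ⌈ rd t η ⌉ ≡ ren η t
  ⌈rd⌉ (ix i) η = refl
  ⌈rd⌉ (so s) η = refl
  ⌈rd⌉ (∏ U T) η = cong₂ ∏ (⌈rd⌉ U η)
    (trans (cong (ren _) (⌈rd⌉ T _)) (close-◂ T (freshFrom-binder η U T)))
  ⌈rd⌉ (ƛ U t) η = cong₂ ƛ (⌈rd⌉ U η)
    (trans (cong (ren _) (⌈rd⌉ t _)) (close-◂ t (freshFrom-binder η U t)))
  ⌈rd⌉ (t ∙ u) η = cong₂ _∙_ (⌈rd⌉ t η) (⌈rd⌉ u η)

  α-refl : ∀ {t} → t ≈αₚ t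
  α-refl = Eq.reflexive (CtxP αP)

  α-trans : ∀ {t u v} → t ≈αₚ u → u ≈αₚ v → t ≈αₚ v
  α-trans = Eq.transitive (CtxP αP)

  α-sym : ∀ {t u} → t ≈αₚ u → u ≈αₚ t
  α-sym = Eq.symmetric (CtxP αP)

  swP-id : ∀ x t → swP x x t ≡ t
  swP-id x (pv v) = cong pv (swapv-id x v)
  swP-id x (ps s) = refl
  swP-id x (pΠ v T t) rewrite swapv-id x v = cong₂ (pΠ v) (swP-id x T) (swP-id x t)
  swP-id x (pλ v T t) rewrite swapv-id x v = cong₂ (pλ v) (swP-id x T) (swP-id x t)
  swP-id x (t · u) = cong₂ _·_ (swP-id x t) (swP-id x u)

  -- The condition admits `z` equal to `x`; `αpΠ` may then fail to apply, but the swap is the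
  -- identity.
  rename-Π : ∀ x z T t → z ∉ del x (fvP t) → pΠ x T t ≈αₚ pΠ z T (swP x z t)
  rename-Π x z T t z∉ with z ≟ x
  ... | yes refl rewrite swP-id x t = α-refl
  ... | no z≢x = Eq.return (baseP (αpΠ λ z∈ → z∉ (∈-del z∈ z≢x)))

  rename-λ : ∀ x z T t → z ∉ del x (fvP t) → pλ x T t ≈αₚ pλ z T (swP x z t)
  rename-λ x z T t z∉ with z ≟ x
  ... | yes refl rewrite swP-id x t = α-refl
  ... | no z≢x = Eq.return (baseP (αpλ λ z∈ → z∉ (∈-del z∈ z≢x)))

  swapv-close : ∀ {x z xs} → z ∉ del x xs → ∀ w → w ∈ xs → swapv x z w ≡ (z ◂ id) (close x w)
  swapv-close {x} {z} z∉ w w∈ with w ≟ x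
  ... | yes refl rewrite ≡ᵇ-refl w = refl
  ... | no w≢x rewrite ≢⇒≡ᵇ-false w≢x with w ≟ z
  ...   | yes refl = ⊥-elim (z∉ (∈-del w∈ w≢x))
  ...   | no w≢z rewrite ≢⇒≡ᵇ-false w≢z = refl

  ⌈sw⌉-◂ : ∀ {x z η d} t → z ∉ del x (fvP t) → ren (close x) ⌈ t ⌉ ≡ ren (lift η) d →
    ⌈ swP x z t ⌉ ≡ ren (z ◂ η) d
  ⌈sw⌉-◂ {x} {z} {η} {d} t z∉ eq = trans (⌈sw⌉ x z t) (trans (⌈⌉-ren-on t (swapv-close z∉))
    (trans (sym (ren-ren _ _ ⌈ t ⌉)) (trans (cong (ren (z ◂ id)) eq)
      (trans (ren-ren _ _ d) (ren-on d λ { zero _ → refl ; (suc i) _ → refl })))))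

  ∏-injective : ∀ {U U′ T T′} → ∏ U T ≡ ∏ U′ T′ → U ≡ U′ × T ≡ T′
  ∏-injective refl = refl , refl

  ƛ-injective : ∀ {U U′ T T′} → ƛ U T ≡ ƛ U′ T′ → U ≡ U′ × T ≡ T′
  ƛ-injective refl = refl , refl

  ∙-injective : ∀ {t t′ u u′} → t ∙ u ≡ t′ ∙ u′ → t ≡ t′ × u ≡ u′
  ∙-injective refl = refl , refl

  freshFrom-del : ∀ η U T x t → ren (close x) ⌈ t ⌉ ≡ ren (lift η) T →
    freshFrom (map η (fv U ++ down (fv T))) ∉ del x (fvP t)
  freshFrom-del η U T x t eq z∈ = freshFrom-binder η U T (subst (_ ∈_) fv≡ z∈)
    where
    fv≡ : del x (fvP t) ≡ map η (down (fv T))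
    fv≡ = trans (sym (fv-close x t)) (trans (cong (down ∘ fv) eq)
      (trans (cong down (fv-ren (lift η) T)) (down-lift η (fv T))))

  cong-Π : ∀ {x T T′ t t′} → T ≈αₚ T′ → t ≈αₚ t′ → pΠ x T t ≈αₚ pΠ x T′ t′
  cong-Π {x} {T′ = T′} {t} p q = α-trans (Eq.gmap (λ T → pΠ x T t) pΠ₁ p) (Eq.gmap (pΠ x T′) pΠ₂ q)

  cong-λ : ∀ {x T T′ t t′} → T ≈αₚ T′ → t ≈αₚ t′ → pλ x T t ≈αₚ pλ x T′ t′
  cong-λ {x} {T′ = T′} {t} p q = α-trans (Eq.gmap (λ T → pλ x T t) pλ₁ p) (Eq.gmap (pλ x T′) pλ₂ q)

  cong-· : ∀ {t t′ u u′} → t ≈αₚ t′ → u ≈αₚ u′ → (t · u) ≈αₚ (t′ · u′)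
  cong-· {t′ = t′} {u} p q = α-trans (Eq.gmap (_· u) ap₁ p) (Eq.gmap (t′ ·_) ap₂ q)

  -- Each binder of `t` is renamed to the name `rd` picks. The recursion is on `d`, since the
  -- swapped body is no longer a subterm of `t`.
  rd-≈α : ∀ d {η} t → ⌈ t ⌉ ≡ ren η d → rd d η ≈αₚ t
  rd-≈α (ix i) (pv x) refl = α-refl
  rd-≈α (so s) (ps s) refl = α-refl
  rd-≈α (∏ U d) {η} (pΠ x T t) eq with ∏-injective eq
  ... | eqT , eqt = α-trans (cong-Π (rd-≈α U T eqT) (rd-≈α d (swP x _ t) (⌈sw⌉-◂ t z∉ eqt)))
    (α-sym (rename-Π x _ T t z∉))
    where z∉ = freshFrom-del η U d x t eqt
  rd-≈α (ƛ U d) {η} (pλ x T t) eq with ƛ-injective eq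
  ... | eqT , eqt = α-trans (cong-λ (rd-≈α U T eqT) (rd-≈α d (swP x _ t) (⌈sw⌉-◂ t z∉ eqt)))
    (α-sym (rename-λ x _ T t z∉))
    where z∉ = freshFrom-del η U d x t eqt
  rd-≈α (d ∙ e) (t · u) eq with ∙-injective eq
  ... | eqt , equ = cong-· (rd-≈α d t eqt) (rd-≈α e u equ)

  -- Both sides are α-equivalent to the readback of their common image.
  ⌈⌉-≈α : ∀ {t t′} → ⌈ t ⌉ ≡ ⌈ t′ ⌉ → t ≈αₚ t′
  ⌈⌉-≈α {t} {t′} eq = α-trans (α-sym (rd-≈α ⌈ t ⌉ t (sym (ren-id ⌈ t ⌉))))
    (rd-≈α ⌈ t ⌉ t′ (trans (sym eq) (sym (ren-id ⌈ t ⌉))))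

  -- Readback of conversion

  _⟶βα_ : PTerm → PTerm → Set
  t ⟶βα u = CtxP βroot t u ⊎ CtxP αP t u

  α⇒↔β* : ∀ {t u} → t ≈αₚ u → t ↔β* u
  α⇒↔β* = Eq.map inj₂

  ⌈⌉-↔β* : ∀ {t u} → ⌈ t ⌉ ≡ ⌈ u ⌉ → t ↔β* u
  ⌈⌉-↔β* = α⇒↔β* ∘ ⌈⌉-≈α

  ↔β*-trans : ∀ {t u v} → t ↔β* u → u ↔β* v → t ↔β* v
  ↔β*-trans = Eq.transitive _⟶βα_

  ↔β*-ctx : ∀ {t u} (F : PTerm → PTerm) → (∀ {R t u} → CtxP R t u → CtxP R (F t) (F u)) →
    t ↔β* u → F t ↔β* F u
  ↔β*-ctx F ctx = Eq.gmap F λ { (inj₁ c) → inj₁ (ctx c) ; (inj₂ c) → inj₂ (ctx c) }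

  -- Allows the binder picked by `rd` to be replaced by any other fresh name, as needed when several
  -- terms must share one.
  rd-∏-⌈⌉ : ∀ {z η U T} → z ∉ map η (down (fv T)) → ⌈ rd (∏ U T) η ⌉ ≡ ⌈ pΠ z (rd U η) (rd T (z ◂ η)) ⌉
  rd-∏-⌈⌉ {z} {η} {U} {T} z∉ = trans (⌈rd⌉ (∏ U T) η) (sym (cong₂ ∏ (⌈rd⌉ U η)
    (trans (cong (ren (close z)) (⌈rd⌉ T _)) (close-◂ T z∉))))

  rd-ƛ-⌈⌉ : ∀ {z η U t} → z ∉ map η (down (fv t)) → ⌈ rd (ƛ U t) η ⌉ ≡ ⌈ pλ z (rd U η) (rd t (z ◂ η)) ⌉
  rd-ƛ-⌈⌉ {z} {η} {U} {t} z∉ = trans (⌈rd⌉ (ƛ U t) η) (sym (cong₂ ƛ (⌈rd⌉ U η)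
    (trans (cong (ren (close z)) (⌈rd⌉ t _)) (close-◂ t z∉))))

  rd-⟨⟩ : ∀ {z η} T u → z ∉ map η (down (fv T)) → ⌈ rd T (z ◂ η) [ z ≔ rd u η ] ⌉ ≡ ⌈ rd (T ⟨ u ⟩) η ⌉
  rd-⟨⟩ {z} {η} T u z∉ = trans (⌈≔⌉ (rd T (z ◂ η)) z (rd u η)) (trans
    (trans (cong (sub _) (⌈rd⌉ T (z ◂ η))) (trans (sub-ren _ _ T) (sub-on T λ
      { zero _ → trans (↦-same {f = ix} z) (⌈rd⌉ u η)
      ; (suc i) i∈ → ↦-other {f = ix} λ { refl → z∉ (∈-map⁺ η (∈-down i∈)) } })))
    (sym (trans (⌈rd⌉ (T ⟨ u ⟩) η) (ren-sub η _ T))))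

  freshFrom-++ˡ : ∀ xs ys → freshFrom (xs ++ ys) ∉ xs
  freshFrom-++ˡ xs ys = freshFrom-∉ (xs ++ ys) ∘ ∈-++⁺ˡ

  freshFrom-++ʳ : ∀ xs ys → freshFrom (xs ++ ys) ∉ ys
  freshFrom-++ʳ xs ys = freshFrom-∉ (xs ++ ys) ∘ ∈-++⁺ʳ xs

  rd-↔β* : ∀ {t u} → t ≅ u → ∀ η → rd t η ↔β* rd u η
  rd-↔β* ≅-refl η = α⇒↔β* α-refl
  rd-↔β* (≅-sym p) η = Eq.symmetric _⟶βα_ (rd-↔β* p η)
  rd-↔β* (≅-trans p q) η = ↔β*-trans (rd-↔β* p η) (rd-↔β* q η)
  rd-↔β* (≅-β {U} {t} {u}) η = ↔β*-trans (Eq.return (inj₁ (baseP β)))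
    (⌈⌉-↔β* (rd-⟨⟩ t u (freshFrom-binder η U t)))
  -- `rd` may name the binders of the two products differently; both are first moved to a name fresh
  -- for both bodies.
  rd-↔β* (≅-∏ {U} {U′} {T} {T′} p q) η = ↔β*-trans
    (⌈⌉-↔β* (rd-∏-⌈⌉ {T = T} (freshFrom-++ˡ xs ys)))
    (↔β*-trans (↔β*-ctx (λ V → pΠ z V (rd T (z ◂ η))) pΠ₁ (rd-↔β* p η))
    (↔β*-trans (↔β*-ctx (pΠ z (rd U′ η)) pΠ₂ (rd-↔β* q (z ◂ η)))
    (⌈⌉-↔β* (sym (rd-∏-⌈⌉ {T = T′} (freshFrom-++ʳ xs ys))))))
    where
    xs = map η (down (fv T))
    ys = map η (down (fv T′))
    z = freshFrom (xs ++ ys)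
  rd-↔β* (≅-ƛ {U} {U′} {t} {t′} p q) η = ↔β*-trans
    (⌈⌉-↔β* (rd-ƛ-⌈⌉ {t = t} (freshFrom-++ˡ xs ys)))
    (↔β*-trans (↔β*-ctx (λ V → pλ z V (rd t (z ◂ η))) pλ₁ (rd-↔β* p η))
    (↔β*-trans (↔β*-ctx (pλ z (rd U′ η)) pλ₂ (rd-↔β* q (z ◂ η)))
    (⌈⌉-↔β* (sym (rd-ƛ-⌈⌉ {t = t′} (freshFrom-++ʳ xs ys))))))
    where
    xs = map η (down (fv t))
    ys = map η (down (fv t′))
    z = freshFrom (xs ++ ys)
  rd-↔β* (≅-∙ {t} {t′} {u} {u′} p q) η =
    ↔β*-trans (↔β*-ctx (_· rd u η) ap₁ (rd-↔β* p η)) (↔β*-ctx (rd t′ η ·_) ap₂ (rd-↔β* q η))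

  -- Readback of typing derivations

  -- Types are compared by their de Bruijn images, hence only up to α.
  _⟨_⟩≼_ : Ctx → (ℕ → Var) → PEnv → Set
  Γ ⟨ η ⟩≼ Θ = ∀ {i T} → Γ i T → ∃[ T′ ] (η i , T′) ∈ Θ × ⌈ T′ ⌉ ≡ ren η T

  ≼-▸ : ∀ {Γ η Θ z U V} → Γ ⟨ η ⟩≼ Θ → ⌈ V ⌉ ≡ ren η U → (Γ ▸ U) ⟨ z ◂ η ⟩≼ (Θ ,ₚ z ∶ V)
  ≼-▸ {Θ = Θ} {U = U} {V} m eq (top refl) = V , ∈-++⁺ʳ Θ (here refl) , trans eq (sym (ren-ren _ suc U))
  ≼-▸ m eq (pop {T = T} i∈ refl) with m i∈
  ... | T′ , x∈ , eq′ = T′ , ∈-++⁺ˡ x∈ , trans eq′ (sym (ren-ren _ suc T))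

  retype : ∀ {Θ t t′ T} → Θ ⊢ₚ t ∶ T → ⌈ t ⌉ ≡ ⌈ t′ ⌉ → Θ ⊢ₚ t′ ∶ T
  retype d eq = p-α d (⌈⌉-≈α eq)

  reconv : ∀ {Θ t T T′ s} → Θ ⊢ₚ t ∶ T → Θ ⊢ₚ T′ ∶ ps s → ⌈ T ⌉ ≡ ⌈ T′ ⌉ → Θ ⊢ₚ t ∶ T′
  reconv d dT eq = p-conv d dT (⌈⌉-↔β* eq)

  rd-⊢ₚ : ∀ {Γ t T} → Γ ⊩ t ∶ T → ∀ {η Θ} → Θ wfₚ → Γ ⟨ η ⟩≼ Θ → Θ ⊢ₚ rd t η ∶ rd T η
  rd-⊢ₚ (d-ix {T = T} i∈ dT) {η} ω m with m i∈
  -- The declared type is only α-equivalent to `rd T η`; the premise `dT` makes the conversion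
  -- possible.
  ... | T′ , x∈ , eq = reconv (p-var ω x∈) (rd-⊢ₚ dT ω m) (trans eq (sym (⌈rd⌉ T η)))
  rd-⊢ₚ (d-so a) ω m = p-srt ω a
  rd-⊢ₚ (d-∏ {U} {T} dU dT ρ) {η} {Θ} ω m =
    retype (p-Π dU′ (rd-⊢ₚ dT (pwf-, dU′ (freshFrom-++ˡ xs ys)) (≼-▸ m (⌈rd⌉ U η))) ρ)
      (sym (rd-∏-⌈⌉ {T = T} (freshFrom-++ʳ xs ys)))
    where
    xs = map proj₁ Θ
    ys = map η (down (fv T))
    dU′ = rd-⊢ₚ dU ω m
  rd-⊢ₚ (d-ƛ {U} {T} {t} dU dΠ dt) {η} {Θ} ω m = reconv
    -- `p-λ` wants one binder for the product and the abstraction, so the name is fresh for `Θ`, `T`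
    -- and `t` at once.
    (retype (p-λ (retype dΠ′ Π≡) (rd-⊢ₚ dt (pwf-, dU′ (freshFrom-++ˡ xs (ys ++ zs))) (≼-▸ m (⌈rd⌉ U η))))
      (sym (rd-ƛ-⌈⌉ {t = t} (freshFrom-++ʳ xs (ys ++ zs) ∘ ∈-++⁺ʳ ys))))
    dΠ′ (sym Π≡)
    where
    xs = map proj₁ Θ
    ys = map η (down (fv T))
    zs = map η (down (fv t))
    dU′ = rd-⊢ₚ dU ω m
    dΠ′ = rd-⊢ₚ dΠ ω m
    Π≡ = rd-∏-⌈⌉ {U = U} {T} (freshFrom-++ʳ xs (ys ++ zs) ∘ ∈-++⁺ˡ)
  rd-⊢ₚ (d-∙ {t} {u} {U} {T} dU dt du dT) {η} ω m =
    reconv (p-app (rd-⊢ₚ dt ω m) (rd-⊢ₚ du ω m)) (rd-⊢ₚ dT ω m) (rd-⟨⟩ T u (freshFrom-binder η U T))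
  rd-⊢ₚ (d-conv d dV p) {η} ω m = p-conv (rd-⊢ₚ d ω m) (rd-⊢ₚ dV ω m) (rd-↔β* p η)

  -- The translation 𝓑

  fvT⊆varsT : ∀ M {x} → x ∈ fvT M → x ∈ varsT M
  fvL⊆varsL : ∀ l {x} → x ∈ fvL l → x ∈ varsL l
  binder⊆ : ∀ {x xs xs′ ys ys′ w} → (∀ {v} → v ∈ xs → v ∈ xs′) → (∀ {v} → v ∈ ys → v ∈ ys′) →
    w ∈ xs ++ del x ys → w ∈ xs′ ++ ys′
  binder⊆ {xs = xs} {xs′} {ys} f g w∈ with ∈-++⁻ xs w∈
  ... | inj₁ w∈xs = ∈-++⁺ˡ (f w∈xs)
  ... | inj₂ w∈ys = ∈-++⁺ʳ xs′ (g (∈-del⁻ ys w∈ys))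
  fvT⊆varsT (Pi x A B) w∈ = there (binder⊆ (fvT⊆varsT A) (fvT⊆varsT B) w∈)
  fvT⊆varsT (Lam x A M) w∈ = there (binder⊆ (fvT⊆varsT A) (fvT⊆varsT M) w∈)
  fvT⊆varsT (var x l) (here refl) = here refl
  fvT⊆varsT (var x l) (there w∈) = there (fvL⊆varsL l w∈)
  fvT⊆varsT (app M l) w∈ = ++⁺ (fvT⊆varsT M) (fvL⊆varsL l) w∈
  fvT⊆varsT (esub N x A M) w∈ =
    there (++⁺ (fvT⊆varsT N) (binder⊆ (fvT⊆varsT A) (fvT⊆varsT M)) w∈)
  fvL⊆varsL (cons M l) w∈ = ++⁺ (fvT⊆varsT M) (fvL⊆varsL l) w∈
  fvL⊆varsL (cat l l') w∈ = ++⁺ (fvL⊆varsL l) (fvL⊆varsL l') w∈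
  fvL⊆varsL (lsub N x A l) w∈ =
    there (++⁺ (fvT⊆varsT N) (binder⊆ (fvT⊆varsT A) (fvL⊆varsL l)) w∈)

  ⌈𝓑⌉ : ∀ M → ⌈ 𝓑 M ⌉ ≡ ⟪ M ⟫
  -- `y` has to avoid bound names as well: an `lsub` binding `y` would substitute into the hole.
  ⌈𝓑ˡ⌉ : ∀ l {y} → y ∉ varsL l → ⌈ 𝓑ˡ y l ⌉ ≡ ⟪ l ⟫ˡ ⟨ ix y ⟩
  ⌈𝓑ˡ≔⌉ : ∀ l N → let z = freshFrom (varsL l) in ⌈ 𝓑ˡ z l [ z ≔ N ] ⌉ ≡ ⟪ l ⟫ˡ ⟨ ⌈ N ⌉ ⟩
  ⌈𝓑⌉ (Pi x A B) = cong₂ ∏ (⌈𝓑⌉ A) (cong (ren (close x)) (⌈𝓑⌉ B))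
  ⌈𝓑⌉ (Lam x A M) = cong₂ ƛ (⌈𝓑⌉ A) (cong (ren (close x)) (⌈𝓑⌉ M))
  ⌈𝓑⌉ (srt s) = refl
  ⌈𝓑⌉ (var x l) = ⌈𝓑ˡ≔⌉ l (pv x)
  ⌈𝓑⌉ (app M l) = trans (⌈𝓑ˡ≔⌉ l (𝓑 M)) (cong (⟪ l ⟫ˡ ⟨_⟩) (⌈𝓑⌉ M))
  ⌈𝓑⌉ (esub P x K M) = trans (⌈≔⌉ (𝓑 M) x (𝓑 P))
    (cong₂ (λ u t → sub (x ↤ u) t) (⌈𝓑⌉ P) (⌈𝓑⌉ M))
  ⌈𝓑ˡ⌉ nil y∉ = refl
  ⌈𝓑ˡ⌉ (cons M l) {y} y∉ = trans (⌈𝓑ˡ≔⌉ l (pv y · 𝓑 M)) (trans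
    (cong (λ t → ⟪ l ⟫ˡ ⟨ ix y ∙ t ⟩) (⌈𝓑⌉ M))
    (sym (sub-sub≡ (λ { zero → cong (ix y ∙_) (↑-⟨⟩ ⟪ M ⟫) ; (suc i) → refl }) ⟪ l ⟫ˡ)))
  ⌈𝓑ˡ⌉ (cat l l') {y} y∉ = trans (⌈𝓑ˡ≔⌉ l' (𝓑ˡ y l)) (trans
    (cong (⟪ l' ⟫ˡ ⟨_⟩) (⌈𝓑ˡ⌉ l (y∉ ∘ ∈-++⁺ˡ)))
    (sym (sub-sub≡ (λ { zero → refl ; (suc i) → refl }) ⟪ l' ⟫ˡ)))
  ⌈𝓑ˡ⌉ (lsub P x K l) {y} y∉ = trans (⌈≔⌉ (𝓑ˡ y l) x (𝓑 P)) (trans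
    (cong₂ (λ u t → sub (x ↤ u) t) (⌈𝓑⌉ P)
      (⌈𝓑ˡ⌉ l (y∉ ∘ there ∘ ∈-++⁺ʳ (varsT P) ∘ ∈-++⁺ʳ (varsT K))))
    (sub-sub-cong
      (λ { zero → ↦-other {f = ix} (y∉ ∘ here) ; (suc w) → sym (↑-⟨⟩ ((x ↤ ⟪ P ⟫) w)) }) ⟪ l ⟫ˡ))
  ⌈𝓑ˡ≔⌉ l N = trans (⌈≔⌉ (𝓑ˡ z l) z N) (trans
    (cong (sub (z ↤ ⌈ N ⌉)) (⌈𝓑ˡ⌉ l z∉)) (trans (sub-sub _ _ ⟪ l ⟫ˡ)
    (⟪⟫ˡ-on l (↦-same {f = ix} z)
      λ w w∈ → ↦-other {f = ix} λ { refl → z∉ (fvL⊆varsL l w∈) })))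
    where
    z = freshFrom (varsL l)
    z∉ = freshFrom-∉ (varsL l)

  ≼-𝓑ₑ : ∀ Γ → ⌊ Γ ⌋ ⟨ id ⟩≼ 𝓑ₑ Γ
  ≼-𝓑ₑ Γ (entry {A = A} x∈ refl) = 𝓑 A , ∈-map⁺ _ x∈ , trans (⌈𝓑⌉ A) (sym (ren-id ⟪ A ⟫))

  -- A type is a sort, which rd reproduces verbatim, or is typed itself and can be converted to.
  readback : ∀ {Γ t T η Θ} → Γ ⊩ t ∶ T → Θ wfₚ → Γ ⟨ η ⟩≼ Θ →
    ∀ {t′ T′} → ⌈ t′ ⌉ ≡ ren η t → ⌈ T′ ⌉ ≡ ren η T → Θ ⊢ₚ t′ ∶ T′
  readback {t = t} {T} {η} d ω m {T′ = T′} eqt eqT with type-correct d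
  ... | inj₂ (s , dT) = reconv d′ (retype (rd-⊢ₚ dT ω m) T≡) T≡
    where
    d′ = retype (rd-⊢ₚ d ω m) (trans (⌈rd⌉ t η) (sym eqt))
    T≡ = trans (⌈rd⌉ T η) (sym eqT)
  readback {t = t} {η = η} d ω m {T′ = ps _} eqt refl | inj₁ (s , refl) =
    retype (rd-⊢ₚ d ω m) (trans (⌈rd⌉ t η) (sym eqt))

  readback-𝓑 : ∀ {Γ M A} → ⌊ Γ ⌋ ⊩ ⟪ M ⟫ ∶ ⟪ A ⟫ → 𝓑ₑ Γ wfₚ → 𝓑ₑ Γ ⊢ₚ 𝓑 M ∶ 𝓑 A
  readback-𝓑 {Γ} {M} {A} d ω = readback d ω (≼-𝓑ₑ Γ)
    (trans (⌈𝓑⌉ M) (sym (ren-id ⟪ M ⟫))) (trans (⌈𝓑⌉ A) (sym (ren-id ⟪ A ⟫)))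

  dom-𝓑ₑ : ∀ Γ → map proj₁ (𝓑ₑ Γ) ≡ dom Γ
  dom-𝓑ₑ Γ = sym (map-∘ Γ)

  -- Readback of a typing needs a well-formed named environment. It is found by descending through
  -- premises to a `wf` derivation; `sound` does not refer back to this, so the recursion is
  -- structural.
  𝓑-wf : ∀ {Γ} → Γ wf → 𝓑ₑ Γ wfₚ
  𝓑-wf-term : ∀ {Γ M A} → Γ ⊢ M ∶ A → 𝓑ₑ Γ wfₚ
  𝓑-wf-list : ∀ {Γ B l C} → Γ ⍮ B ⊢ l ∶ C → 𝓑ₑ Γ wfₚ
  𝓑-wf wf-∅ = pwf-∅
  𝓑-wf (wf-, {Γ} {x} {A} dA x∉) = subst _wfₚ (sym (map-++ _ Γ [ x , A ]))
    (pwf-, (readback-𝓑 {M = A} {srt _} (proj₂ (sound dA)) (𝓑-wf-term dA))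
      (subst (x ∉_) (sym (dom-𝓑ₑ Γ)) x∉))
  𝓑-wf-term (t-srt ω _) = 𝓑-wf ω
  𝓑-wf-term (t-Pi dA _ _) = 𝓑-wf-term dA
  𝓑-wf-term (t-Lam dΠ _) = 𝓑-wf-term dΠ
  𝓑-wf-term (t-var dl _) = 𝓑-wf-list dl
  𝓑-wf-term (t-conv dM _ _) = 𝓑-wf-term dM
  𝓑-wf-term (t-app dM _) = 𝓑-wf-term dM
  𝓑-wf-term (t-esub _ _ _ ω) = 𝓑-wf ω
  𝓑-wf-term (t-α dM _) = 𝓑-wf-term dM
  𝓑-wf-list (l-nil dA) = 𝓑-wf-term dA
  𝓑-wf-list (l-cons dΠ _ _) = 𝓑-wf-term dΠ
  𝓑-wf-list (l-convR dl _ _) = 𝓑-wf-list dl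
  𝓑-wf-list (l-convL dl _ _) = 𝓑-wf-list dl
  𝓑-wf-list (l-cat dl _) = 𝓑-wf-list dl
  𝓑-wf-list (l-lsub _ _ _ ω) = 𝓑-wf ω
  𝓑-wf-list (l-α dl _) = 𝓑-wf-list dl

  𝓑-term : ∀ {Γ M A} → Γ ⊢ M ∶ A → 𝓑ₑ Γ ⊢ₚ 𝓑 M ∶ 𝓑 A
  𝓑-term {M = M} {A} d = readback-𝓑 {M = M} {A} (proj₂ (sound d)) (𝓑-wf-term d)

  𝓑-list : ∀ {Γ B l C} → Γ ⍮ B ⊢ l ∶ C → ∀ y → y ∉ dom Γ → y ∉ varsL l →
    (𝓑ₑ Γ ,ₚ y ∶ 𝓑 B) ⊢ₚ 𝓑ˡ y l ∶ 𝓑 C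
  𝓑-list {Γ} {B} {l} {C} d y y∉Γ y∉l with soundˡ d
  -- The indices are named by `y ◂ id`: the hole is called `y`, and the shifted names return to
  -- themselves.
  ... | _ , (s , dB) , dl = readback dl
    (pwf-, (readback-𝓑 {M = B} {srt s} dB (𝓑-wf-list d)) (subst (y ∉_) (sym (dom-𝓑ₑ Γ)) y∉Γ))
    (≼-▸ (≼-𝓑ₑ Γ) (trans (⌈𝓑⌉ B) (sym (ren-id ⟪ B ⟫))))
    (trans (⌈𝓑ˡ⌉ l y∉l) (trans (sub-cong (λ { zero → refl ; (suc i) → refl }) ⟪ l ⟫ˡ)
      (sym (ren≡sub (y ◂ id) ⟪ l ⟫ˡ))))
    (trans (⌈𝓑⌉ C) (sym (trans (ren-ren (y ◂ id) suc ⟪ C ⟫) (ren-id ⟪ C ⟫))))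

theorem4p4 : (S : Set) (Ax : S → S → Set) (Rl : S → S → S → Set) →
    let open Calculi S Ax Rl in
    (∀ {Γ M A} → Γ ⊢ M ∶ A → 𝓑ₑ Γ ⊢ₚ 𝓑 M ∶ 𝓑 A)
    × (∀ {Γ B l C} → Γ ⍮ B ⊢ l ∶ C → ∀ y → y ∉ dom Γ → y ∉ varsL l →
    (𝓑ₑ Γ ,ₚ y ∶ 𝓑 B) ⊢ₚ 𝓑ˡ y l ∶ 𝓑 C)
    × (∀ {Γ} → Γ wf → 𝓑ₑ Γ wfₚ)
theorem4p4 S Ax Rl = 𝓑-term , 𝓑-list , 𝓑-wf
  where open Soundness S Ax Rl
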